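{- Let $H_1$ and $H_2$ be two finite simple graphs on $n$ nodes. The following statements are equivalent: (i) $H_1$ and $H_2$ are isomorphic. (ii) For all graphs $G$ (without isolated vertex) on at most $n$ nodes and having at most $\left\lfloor \frac{1}{2}\binom{n}{2}\right\rfloor$ edges, $\mathcal{P}_{n,G}(H_1)=\mathcal{P}_{n,G}(H_2)$. (iii) For all graphs $G$ (without isolated vertex) on at most $n$ nodes and having at most $\left\lfloor \frac{1}{2}\binom{n}{2}\right\rfloor$ edges, $\mathcal{M}_{G}(H_1)=\mathcal{M}_{G}(H_2)$.
   Context: Graphs are finite, undirected, without loops or multiple edges; $n$ is a positive integer. $\mathbb{K}$ is a field of characteristic $0$. Let $x_{ij}$, for integers $0<i<j$, be commuting variables; infinite formal sums of monomials are allowed. Action: for $\sigma \in \mathfrak{S}_m$ and $1\le i<j\le m$, $\sigma\cdot(i,j) := (\min(\sigma(i),\sigma(j)),\max(\sigma(i),\sigma(j)))$. Definition of $\mathcal{M}_G$: let $G$ be a graph on $m\ge 2$ vertices without isolated vertex. Choose any labeling of the vertices of $G$ by $1,\dots,m$ and let $a_{ij}\in\{0,1\}$ ($1\le i<j\le m$) be $1$ if and only if $i$ and $j$ are adjacent. Let $R\subset\mathfrak{S}_m$ be a set of permutations such that the families $(a_{\sigma\cdot(i,j)})_{1\le i<j\le m}$, $\sigma\in R$, are pairwise distinct and exhaust all the families obtained for $\sigma\in\mathfrak{S}_m$. Then $$\mathcal{M}_G := \sum_{0<r_1<\dots<r_m}\ \sum_{\sigma\in R}\ \prod_{1\le i<j\le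 m} x_{r_i r_j}^{a_{\sigma\cdot(i,j)}} .$$ By convention the one-vertex graph $\bullet$ counts as a graph without isolated vertex, and $\mathcal{M}_\bullet:=1$. $\mathcal{P}_{n,G}\in\mathbb{K}[x_{ij}\mid 1\le i<j\le n]$ is the polynomial obtained from $\mathcal{M}_G$ by setting to $0$ every variable having an index greater than $n$. Evaluation: for a graph $H$ on $n$ vertices, choose a labeling of its vertices by $1,\dots,n$, put $b_{ij}=1$ if $i<j\le n$ are adjacent in $H$ and $b_{ij}=0$ for all other pairs $i<j$ (in particular if $j>n$). $\mathcal{M}_G(H)$ and $\mathcal{P}_{n,G}(H)$ are the values obtained by substituting $x_{ij}=b_{ij}$; they do not depend on the labeling.
   Formalization: The case n = 2 is excluded: there the edge bound is 0, so the only admissible G is the one-vertex graph with value 1, and (ii), (iii) hold for the non-isomorphic graphs with one edge and with no edge on two nodes. -}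

module Defs where

open import Algebra.Apartness.Bundles using (HeytingField; HeytingCommutativeRing)
open import Algebra.Bundles using (CommutativeRing; Semiring)
import Algebra.Definitions.RawSemiring as RawSemiringDefinitions
open import Data.Bool.Base using (Bool; true; false; if_then_else_)
open import Data.Empty using (⊥)
open import Data.Fin.Base as Fin using (Fin; zero; suc; fromℕ<)
import Data.Fin.Properties as Fin
open import Data.Fin.Permutation using (Permutation′; _⟨$⟩ʳ_; _⟨$⟩ˡ_; inverseˡ; inverseʳ)
open import Data.List.Base using (List; []; _∷_; map; foldr; concatMap; cartesianProduct; allFin; upTo; [_])
open import Data.List.Membership.Propositional using (_∈_; _∉_; lose)
open import Data.List.Membership.Propositional.Properties
  using (∈-map⁺; ∈-map⁻; ∈-upTo⁺; ∈-allFin; ∈-cartesianProduct⁺; ∈-concatMap⁺)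
open import Data.List.Relation.Binary.Disjoint.Propositional using (Disjoint)
open import Data.List.Relation.Unary.All as All using ()
import Data.List.Relation.Unary.All.Properties as All
open import Data.List.Relation.Unary.AllPairs as AllPairs using ()
import Data.List.Relation.Unary.AllPairs.Properties as AllPairs
open import Data.List.Relation.Unary.Any using (here; there)
open import Data.List.Relation.Unary.Unique.Propositional using (Unique)
import Data.List.Relation.Unary.Unique.Propositional.Properties as Unique
open import Data.Maybe.Base as Maybe using (Maybe; just; nothing)
open import Data.Nat.Base using (ℕ; zero; suc; _+_; _<_; _≤_; s≤s)
open import Data.Nat.Properties using (_<?_; _≤?_; <-trans; <-irrelevant; ≰⇒>; <⇒≱)
open import Data.Product.Base using (Σ; ∃-syntax; _×_; _,_; proj₁; proj₂)
open import Data.Unit.Base using (⊤; tt)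
open import Function.Base using (_∘_)
open import Level using (_⊔_; 0ℓ) renaming (suc to lsuc)
open import Relation.Binary.Definitions using (tri<; tri≈; tri>)
open import Relation.Binary.PropositionalEquality as ≡ using (_≡_; _≢_; cong; subst; trans)
open import Relation.Nullary.Decidable using (yes; no)
open import Relation.Nullary.Negation using (¬_; contradiction)

record Graph (n : ℕ) : Set where
  field
    adj        : Fin n → Fin n → Bool
    adj-sym    : ∀ i j → adj i j ≡ adj j i
    adj-irrefl : ∀ i → adj i i ≡ false

open Graph public

infix 4 _≅_

_≅_ : ∀ {n} → Graph n → Graph n → Set
_≅_ {n} G H =
  Σ (Permutation′ n) λ π → ∀ i j → adj G i j ≡ adj H (π ⟨$⟩ʳ i) (π ⟨$⟩ʳ j)

-- The one-vertex graph counts as having no isolated vertex; the graph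
-- without vertices is excluded.
NoIsolatedVertex : ∀ {m} → Graph m → Set
NoIsolatedVertex {zero}        G = ⊥
NoIsolatedVertex {suc zero}    G = ⊤
NoIsolatedVertex {suc (suc _)} G = ∀ i → ∃[ j ] adj G i j ≡ true

record Pair (m : ℕ) : Set where
  constructor pair
  field
    fst     : Fin m
    snd     : Fin m
    fst<snd : fst Fin.< snd

pairsFrom : ∀ {m} → Fin m × Fin m → List (Pair m)
pairsFrom (i , j) with i Fin.<? j
... | yes i<j = [ pair i j i<j ]
... | no  _   = []

pairs : ∀ m → List (Pair m)
pairs m = concatMap pairsFrom (cartesianProduct (allFin m) (allFin m))

a : ∀ {m} → Graph m → Pair m → ℕ
a G (pair i j _) = if adj G i j then 1 else 0

edges : ∀ {m} → Graph m → ℕ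
edges {m} G = foldr _+_ 0 (map (a G) (pairs m))

⟨$⟩ʳ-injective : ∀ {m} (σ : Permutation′ m) {i j} → σ ⟨$⟩ʳ i ≡ σ ⟨$⟩ʳ j → i ≡ j
⟨$⟩ʳ-injective σ eq =
  trans (≡.sym (inverseˡ σ)) (trans (cong (σ ⟨$⟩ˡ_) eq) (inverseˡ σ))

-- The pair (min (σ i) (σ j) , max (σ i) (σ j)).
infixr 8 _·_

_·_ : ∀ {m} → Permutation′ m → Pair m → Pair m
σ · pair i j i<j with Fin.<-cmp (σ ⟨$⟩ʳ i) (σ ⟨$⟩ʳ j)
... | tri< σi<σj _ _ = pair (σ ⟨$⟩ʳ i) (σ ⟨$⟩ʳ j) σi<σj
... | tri> _ _ σj<σi = pair (σ ⟨$⟩ʳ j) (σ ⟨$⟩ʳ i) σj<σi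
... | tri≈ _ σi≡σj _ = contradiction (⟨$⟩ʳ-injective σ σi≡σj) (Fin.<⇒≢ i<j)

-- A set R of permutations whose families (a (σ · p))ₚ are pairwise
-- distinct and exhaust all such families.  The choice of R is immaterial
-- for the sums below, so it is kept as an explicit argument.
record Representatives {m} (G : Graph m) : Set where
  field
    size     : ℕ
    perm     : Fin size → Permutation′ m
    distinct : ∀ s t → (∀ p → a G (perm s · p) ≡ a G (perm t · p)) → s ≡ t
    exhaust  : ∀ σ → ∃[ s ] (∀ p → a G (σ · p) ≡ a G (perm s · p))

-- The variables x i j with 0 < i < j, written var i j.
record Var : Set where
  constructor var
  field
    i   : ℕ
    j   : ℕ
    0<i : 0 < i
    i<j : i < j

Var≤ : ℕ → Set
Var≤ n = Σ Var λ v → Var.j v ≤ n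

-- The vertex k : Fin n carries the label 1 + k.
labelsAdjacent : ∀ {n} → Graph n → Var → Bool
labelsAdjacent {n} H (var (suc i) (suc j) _ (s≤s i<j)) with suc j ≤? n
... | yes j<n = adj H (fromℕ< (<-trans i<j j<n)) (fromℕ< j<n)
... | no  _   = false

-- Sequences lo < r₁ < … < rₘ; the sums below use lo = 0.
infixr 5 _∷⟨_⟩_

data Increasing (lo : ℕ) : ℕ → Set where
  []      : Increasing lo 0
  _∷⟨_⟩_ : ∀ {m} (r : ℕ) → lo < r → Increasing r m → Increasing lo (suc m)

infix 9 _‼_

_‼_ : ∀ {lo m} → Increasing lo m → Fin m → ℕ
(r ∷⟨ _ ⟩ rs) ‼ zero  = r
(r ∷⟨ _ ⟩ rs) ‼ suc k = rs ‼ k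

‼-lower : ∀ {lo m} (r : Increasing lo m) k → lo < r ‼ k
‼-lower (r ∷⟨ lo<r ⟩ rs) zero    = lo<r
‼-lower (r ∷⟨ lo<r ⟩ rs) (suc k) = <-trans lo<r (‼-lower rs k)

‼-mono : ∀ {lo m} (r : Increasing lo m) {k l} → k Fin.< l → r ‼ k < r ‼ l
‼-mono (r ∷⟨ _ ⟩ rs) {zero}  {suc l} _         = ‼-lower rs l
‼-mono (r ∷⟨ _ ⟩ rs) {suc k} {suc l} (s≤s k<l) = ‼-mono rs k<l

xᵣ : ∀ {m} → Increasing 0 m → Pair m → Var
xᵣ r (pair i j i<j) = var (r ‼ i) (r ‼ j) (‼-lower r i) (‼-mono r i<j)

Bounded : ∀ n {lo m} → Increasing lo m → Set
Bounded n r = ∀ k → r ‼ k ≤ n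

mutual
  bounded : ∀ n lo m → List (Increasing lo m)
  bounded n lo zero    = [ [] ]
  bounded n lo (suc m) = concatMap (boundedFrom n lo m) (upTo (suc n))

  boundedFrom : ∀ n lo m → ℕ → List (Increasing lo (suc m))
  boundedFrom n lo m r with lo <? r
  ... | yes lo<r = map (r ∷⟨ lo<r ⟩_) (bounded n r m)
  ... | no  _    = []

bounded-complete : ∀ n {lo m} (r : Increasing lo m) → Bounded n r → r ∈ bounded n lo m
bounded-complete n []              _  = here ≡.refl
bounded-complete n {lo} {suc m} (r ∷⟨ lo<r ⟩ rs) r≤n =
  ∈-concatMap⁺ (boundedFrom n lo m) (lose (∈-upTo⁺ (s≤s (r≤n zero))) step)
  where
  step : (r ∷⟨ lo<r ⟩ rs) ∈ boundedFrom n lo m r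
  step with lo <? r
  ... | no  lo≮r = contradiction lo<r lo≮r
  ... | yes p rewrite <-irrelevant p lo<r =
    ∈-map⁺ (r ∷⟨ lo<r ⟩_) (bounded-complete n rs (r≤n ∘ suc))

boundedFrom-head : ∀ n lo m r {s} → s ∈ boundedFrom n lo m r → s ‼ zero ≡ r
boundedFrom-head n lo m r s∈ with lo <? r
... | yes lo<r with ∈-map⁻ (r ∷⟨ lo<r ⟩_) s∈
...   | _ , _ , ≡.refl = ≡.refl

∷-injective : ∀ {lo m r} {lo<r : lo < r} {s t : Increasing r m} →
              r ∷⟨ lo<r ⟩ s ≡ r ∷⟨ lo<r ⟩ t → s ≡ t
∷-injective ≡.refl = ≡.refl

mutual
  bounded-unique : ∀ n lo m → Unique (bounded n lo m)
  bounded-unique n lo zero    = All.[] AllPairs.∷ AllPairs.[]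
  bounded-unique n lo (suc m) = Unique.concat⁺
    (All.map⁺ (All.universal (boundedFrom-unique n lo m) (upTo (suc n))))
    (AllPairs.map⁺ (AllPairs.map disjoint (Unique.upTo⁺ (suc n))))
    where
    disjoint : ∀ {r r′} → r ≢ r′ → Disjoint (boundedFrom n lo m r) (boundedFrom n lo m r′)
    disjoint {r} {r′} r≢r′ (s∈ , s∈′) =
      r≢r′ (trans (≡.sym (boundedFrom-head n lo m r s∈)) (boundedFrom-head n lo m r′ s∈′))

  boundedFrom-unique : ∀ n lo m r → Unique (boundedFrom n lo m r)
  boundedFrom-unique n lo m r with lo <? r
  ... | yes lo<r = Unique.map⁺ ∷-injective (bounded-unique n r m)
  ... | no  _    = AllPairs.[]

-- An entry (v , e) is the factor v ^ e.
Monomial : Set → Set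
Monomial V = List (V × ℕ)

-- The result of setting to 0 the variables having an index greater than
-- n; nothing stands for 0.
setZeroMonomial : ∀ n → Monomial Var → Maybe (Monomial (Var≤ n))
setZeroMonomial n []                = just []
setZeroMonomial n ((v , zero)  ∷ μ) = setZeroMonomial n μ
setZeroMonomial n ((v , suc e) ∷ μ) with Var.j v ≤? n
... | yes j≤n = Maybe.map (((v , j≤n) , suc e) ∷_) (setZeroMonomial n μ)
... | no  _   = nothing

monomial : ∀ {m} → Graph m → Increasing 0 m → Permutation′ m → Monomial Var
monomial {m} G r σ = map (λ p → xᵣ r p , a G (σ · p)) (pairs m)

pair∈pairs : ∀ {m} (p : Pair m) → p ∈ pairs m
pair∈pairs {m} (pair i j i<j) =
  ∈-concatMap⁺ pairsFrom (lose (∈-cartesianProduct⁺ (∈-allFin i) (∈-allFin j)) step)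
  where
  step : pair i j i<j ∈ pairsFrom (i , j)
  step with i Fin.<? j
  ... | no  i≮j = contradiction i<j i≮j
  ... | yes p rewrite <-irrelevant p i<j = here ≡.refl

a-action : ∀ {m} (G : Graph m) σ (p : Pair m) →
           adj G (σ ⟨$⟩ʳ Pair.fst p) (σ ⟨$⟩ʳ Pair.snd p) ≡ true → a G (σ · p) ≡ 1
a-action G σ (pair i j i<j) e with Fin.<-cmp (σ ⟨$⟩ʳ i) (σ ⟨$⟩ʳ j)
... | tri< _ _ _ rewrite e = ≡.refl
... | tri> _ _ _ rewrite adj-sym G (σ ⟨$⟩ʳ j) (σ ⟨$⟩ʳ i) | e = ≡.refl
... | tri≈ _ eq _ =
  contradiction (trans (≡.sym e) (trans (cong (adj G (σ ⟨$⟩ʳ i)) (≡.sym eq)) (adj-irrefl G _)))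
                λ ()

pairAbove : ∀ {m n} (r : Increasing 0 m) (P : Fin m → Fin m → Set) →
            (∀ {i j} → P i j → P j i) → (∀ {i} → ¬ P i i) →
            ∀ {k l} → P k l → n < r ‼ k →
            ∃[ p ] P (Pair.fst p) (Pair.snd p) × n < r ‼ Pair.snd p
pairAbove r P P-sym P-irr {k} {l} Pkl n<k with Fin.<-cmp k l
... | tri< k<l _ _    = pair k l k<l , Pkl , <-trans n<k (‼-mono r k<l)
... | tri≈ _ ≡.refl _ = contradiction Pkl P-irr
... | tri> _ _ l<k    = pair l k l<k , P-sym Pkl , n<k

large : ∀ {m} {G : Graph (2 + m)} n r σ → NoIsolatedVertex G → ¬ Bounded n r →
        ∃[ v ] (v , 1) ∈ monomial G r σ × n < Var.j v
large {m} {G} n r σ noIsolated r≰n =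
  let k , r‼k≰n = Fin.¬∀⟶∃¬ (2 + m) (λ k → r ‼ k ≤ n) (λ k → r ‼ k ≤? n) r≰n
      w , kw    = noIsolated (σ ⟨$⟩ʳ k)
      p , e , n< = pairAbove r (λ i j → adj G (σ ⟨$⟩ʳ i) (σ ⟨$⟩ʳ j) ≡ true)
                     (λ {i} {j} → trans (adj-sym G (σ ⟨$⟩ʳ j) (σ ⟨$⟩ʳ i)))
                     (λ e → contradiction (trans (≡.sym e) (adj-irrefl G _)) λ ())
                     (trans (cong (adj G (σ ⟨$⟩ʳ k)) (inverseʳ σ {w})) kw)
                     (≰⇒> r‼k≰n)
  in xᵣ r p
   , subst (λ e → (xᵣ r p , e) ∈ monomial G r σ) (a-action G σ p e)
       (∈-map⁺ (λ p → xᵣ r p , a G (σ · p)) (pair∈pairs p))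
   , n<

setZeroMonomial-large : ∀ n {v} μ → (v , 1) ∈ μ → n < Var.j v → setZeroMonomial n μ ≡ nothing
setZeroMonomial-large n {v} (_ ∷ μ) (here ≡.refl) n<j with Var.j v ≤? n
... | yes j≤n = contradiction j≤n (<⇒≱ n<j)
... | no  _   = ≡.refl
setZeroMonomial-large n ((_ , zero) ∷ μ) (there v∈) n<j = setZeroMonomial-large n μ v∈ n<j
setZeroMonomial-large n ((w , suc _) ∷ μ) (there v∈) n<j with Var.j w ≤? n
... | yes _ rewrite setZeroMonomial-large n μ v∈ n<j = ≡.refl
... | no  _ = ≡.refl

labelsAdjacent-large : ∀ {n} (H : Graph n) v → n < Var.j v → labelsAdjacent H v ≡ false
labelsAdjacent-large {n} H (var (suc i) (suc j) _ (s≤s _)) n<j with suc j ≤? n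
... | yes j≤n = contradiction j≤n (<⇒≱ n<j)
... | no  _   = ≡.refl

module _ {c ℓ₁ ℓ₂} (K : HeytingField c ℓ₁ ℓ₂) where

  open HeytingField K
    renaming (_+_ to _+ᴷ_; _*_ to _*ᴷ_; refl to ≈-refl; trans to ≈-trans)

  private
    𝕂 = HeytingCommutativeRing.commutativeRing heytingCommutativeRing
  open RawSemiringDefinitions (Semiring.rawSemiring (CommutativeRing.semiring 𝕂)) using (_^_)
    renaming (_×_ to _×ᴷ_)

  CharacteristicZero : Set ℓ₁
  CharacteristicZero = ∀ n → ¬ (suc n ×ᴷ 1# ≈ 0#)

  Term : Set → Set c
  Term V = Carrier × Monomial V

  coefficient : ∀ {V} → Term V → Carrier
  coefficient = proj₁

  record FormalSum (V : Set) : Set (lsuc 0ℓ ⊔ c) where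
    field
      Index : Set
      term  : Index → Term V

  open FormalSum

  Polynomial : Set → Set c
  Polynomial V = List (Term V)

  ∑ : List Carrier → Carrier
  ∑ = foldr _+ᴷ_ 0#

  evalMonomial : ∀ {V} → (V → Carrier) → Monomial V → Carrier
  evalMonomial b []            = 1#
  evalMonomial b ((v , e) ∷ μ) = (b v ^ e) *ᴷ evalMonomial b μ

  evalTerm : ∀ {V} → (V → Carrier) → Term V → Carrier
  evalTerm b (q , μ) = q *ᴷ evalMonomial b μ

  evalPolynomial : ∀ {V} → (V → Carrier) → Polynomial V → Carrier
  evalPolynomial b p = ∑ (map (evalTerm b) p)

  record FiniteSupport {I : Set} (f : I → Carrier) : Set (c ⊔ ℓ₁) where
    field
      support : List I
      unique  : Unique support
      outside : ∀ {i} → i ∉ support → f i ≈ 0#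

  open FiniteSupport

  evalSum : ∀ {V} (b : V → Carrier) (S : FormalSum V) →
            FiniteSupport (λ i → evalTerm b (term S i)) → Carrier
  evalSum b S fin = ∑ (map (λ i → evalTerm b (term S i)) (support fin))

  toPolynomial : ∀ {V} (S : FormalSum V) →
                 FiniteSupport (λ i → coefficient (term S i)) → Polynomial V
  toPolynomial S fin = map (term S) (support fin)

  setZeroTerm : ∀ n → Term Var → Term (Var≤ n)
  setZeroTerm n (q , μ) with setZeroMonomial n μ
  ... | just ν  = q , ν
  ... | nothing = 0# , []

  setZero : ∀ n → FormalSum Var → FormalSum (Var≤ n)
  setZero n S = record { Index = Index S ; term = λ i → setZeroTerm n (term S i) }

  one : FormalSum Var
  one = record { Index = ⊤ ; term = λ _ → 1# , [] }

  M-sum : ∀ {m} (G : Graph m) → Representatives G → FormalSum Var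
  M-sum {m} G R = record
    { Index = Increasing 0 m × Fin size
    ; term  = λ (r , s) → 1# , monomial G r (perm s)
    }
    where open Representatives R

  -- M is 1 for the one-vertex graph by convention; the general formula would
  -- be an infinite sum of 1s.
  M : ∀ {m} (G : Graph m) → Representatives G → FormalSum Var
  M {zero}        G R = M-sum G R
  M {suc zero}    G R = one
  M {suc (suc _)} G R = M-sum G R

  b : ∀ {n} → Graph n → Var → Carrier
  b H v = if labelsAdjacent H v then 1# else 0#

  evalMonomial-zero : ∀ {V} (b : V → Carrier) {v} μ → b v ≡ 0# → (v , 1) ∈ μ →
                      evalMonomial b μ ≈ 0#
  evalMonomial-zero b {v} ((_ , _) ∷ μ) bv≡0 (here ≡.refl) rewrite bv≡0 =
    ≈-trans (*-congʳ (zeroˡ 1#)) (zeroˡ _)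
  evalMonomial-zero b (_ ∷ μ) bv≡0 (there v∈) =
    ≈-trans (*-congˡ (evalMonomial-zero b μ bv≡0 v∈)) (zeroʳ _)

  setZeroTerm-nothing : ∀ n q μ → setZeroMonomial n μ ≡ nothing →
                        coefficient (setZeroTerm n (q , μ)) ≈ 0#
  setZeroTerm-nothing n q μ eq rewrite eq = ≈-refl

  module _ {m} (G : Graph (2 + m)) (R : Representatives G) (n : ℕ) where
    open Representatives R

    boundedIndices : List (Index (M-sum G R))
    boundedIndices = cartesianProduct (bounded n 0 (2 + m)) (allFin size)

    boundedSupport : ∀ {f : Index (M-sum G R) → Carrier} →
                     (∀ r s → ¬ Bounded n r → f (r , s) ≈ 0#) → FiniteSupport f
    boundedSupport f≈0 = record
      { support = boundedIndices
      ; unique  = Unique.cartesianProduct⁺ (bounded-unique n 0 (2 + m)) (Unique.allFin⁺ size)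
      ; outside = λ {(r , s)} i∉ → f≈0 r s λ r≤n →
          i∉ (∈-cartesianProduct⁺ (bounded-complete n r r≤n) (∈-allFin s))
      }

  unitSupport : ∀ {f : ⊤ → Carrier} → FiniteSupport f
  unitSupport = record
    { support = [ tt ]
    ; unique  = All.[] AllPairs.∷ AllPairs.[]
    ; outside = λ tt∉ → contradiction (here ≡.refl) tt∉
    }

  -- A term of M indexed by r with some rₖ > n contains a variable having
  -- an index greater than n, because G has no isolated vertex.
  M-support : ∀ {m} (G : Graph m) (R : Representatives G) → NoIsolatedVertex G →
              ∀ {n} (H : Graph n) → FiniteSupport (λ i → evalTerm (b H) (term (M G R) i))
  M-support {suc zero}    G R _          H = unitSupport
  M-support {suc (suc m)} G R noIsolated {n} H = boundedSupport G R n λ r s r≰n →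
    let v , v∈ , n<j = large {G = G} n r (Representatives.perm R s) noIsolated r≰n in
    ≈-trans
      (*-congˡ (evalMonomial-zero (b H) _
        (cong (if_then 1# else 0#) (labelsAdjacent-large H v n<j)) v∈))
      (zeroʳ _)

  P-support : ∀ n {m} (G : Graph m) (R : Representatives G) → NoIsolatedVertex G →
              FiniteSupport (λ i → coefficient (term (setZero n (M G R)) i))
  P-support n {suc zero}    G R _          = unitSupport
  P-support n {suc (suc m)} G R noIsolated = boundedSupport G R n λ r s r≰n →
    let μ = monomial G r (Representatives.perm R s)
        v , v∈ , n<j = large {G = G} n r (Representatives.perm R s) noIsolated r≰n in
    setZeroTerm-nothing n 1# μ (setZeroMonomial-large n μ v∈ n<j)

  P : ∀ n {m} (G : Graph m) (R : Representatives G) → NoIsolatedVertex G → Polynomial (Var≤ n)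
  P n G R noIsolated = toPolynomial (setZero n (M G R)) (P-support n G R noIsolated)

  evalM : ∀ {m} (G : Graph m) (R : Representatives G) → NoIsolatedVertex G →
          ∀ {n} → Graph n → Carrier
  evalM G R noIsolated H = evalSum (b H) (M G R) (M-support G R noIsolated H)

  evalP : ∀ n {m} (G : Graph m) (R : Representatives G) → NoIsolatedVertex G →
          Graph n → Carrier
  evalP n G R noIsolated H = evalPolynomial (b H ∘ proj₁) (P n G R noIsolated)

{-# OPTIONS --safe #-}

-- The value of M_G at H counts the copies of G in H.  If A is obtained from G
-- by adding isolated vertices, every copy is the image of A under exactly
-- |Aut A| permutations of the vertices, so the values M_G(H) for the G with at
-- most k edges determine the number of permutations mapping the edge set of A
-- into that of H, for all A with at most k edges.  By inclusion–exclusion they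
-- also determine how many permutations map A into the edges and B into the
-- non-edges of H, whenever |A| + |B| ≤ k.  Let k = ⌊N/2⌋ with N = n(n-1)/2.
-- Taking for A single edges gives |E(H₁)| = |E(H₂)|.  Then take A = E(H₁) and
-- B = ∅ if |E(H₁)| ≤ k, and A = ∅ and B the set of non-edges of H₁ otherwise: a
-- permutation so obtained is an isomorphism, because the edge numbers agree.

module Submission where

open import Defs
open import Algebra.Apartness.Bundles using (HeytingField; HeytingCommutativeRing)
open import Algebra.Bundles using (CommutativeRing; Semiring)
import Algebra.Definitions.RawSemiring as RawSemiringDefinitions
import Algebra.Properties.CommutativeSemigroup as CommutativeSemigroupProperties
import Algebra.Properties.Group
import Algebra.Properties.Monoid.Mult
open import Data.Bool.Base using (Bool; true; false; if_then_else_)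
import Data.Bool.Properties as Bool
open import Data.Fin.Base as Fin using (Fin; zero; suc; toℕ; fromℕ<; punchIn)
open import Data.Fin.Permutation as Perm
  using (Permutation′; _⟨$⟩ʳ_; _⟨$⟩ˡ_; _∘ₚ_; flip; inverseˡ; inverseʳ; transpose; insert; remove;
         insert-punchIn; punchIn-permute)
import Data.Fin.Properties as Fin
open import Data.List.Base
  using (List; []; _∷_; [_]; _++_; map; concatMap; cartesianProduct; filter; deduplicate; length;
         lookup; allFin; upTo)
open import Data.List.Membership.Propositional using (_∈_; find; lose)
open import Data.List.Membership.Propositional.Properties
  using (∈-map⁺; ∈-map⁻; ∈-filter⁺; ∈-filter⁻; ∈-allFin; ∈-upTo⁻; ∈-lookup; ∈-concatMap⁻;
         ∈-cartesianProduct⁺; ∈-cartesianProduct⁻)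
open import Data.List.Properties using (length-filter; length-tabulate; map-++; map-∘; map-tabulate)
open import Data.List.Relation.Binary.Disjoint.Propositional using (Disjoint)
open import Data.List.Relation.Unary.All as All using (All; []; _∷_)
import Data.List.Relation.Unary.All.Properties as All
open import Data.List.Relation.Unary.AllPairs as AllPairs using (AllPairs; []; _∷_)
import Data.List.Relation.Unary.AllPairs.Properties as AllPairs
open import Data.List.Relation.Unary.Any as Any using (Any; here; there)
import Data.List.Relation.Unary.Any.Properties as Any
import Data.List.Relation.Unary.Unique.DecSetoid.Properties as UniqueDec
open import Data.List.Relation.Unary.Unique.Propositional using (Unique)
import Data.List.Relation.Unary.Unique.Propositional.Properties as Unique
open import Data.Maybe.Base using (just; nothing)
open import Data.Nat.Base
  using (ℕ; zero; suc; _+_; _*_; _≤_; _<_; z≤n; s≤s; z<s; s≤s⁻¹; ⌊_/2⌋; NonZero; >-nonZero)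
open import Data.Nat.Combinatorics using (_C_; nC1≡n; nCk+nC[k+1]≡[n+1]C[k+1])
open import Data.Nat.ListAction using (sum)
open import Data.Nat.ListAction.Properties using (sum-++)
open import Data.Nat.Properties
  using (*-cancelʳ-≡; *-cancelˡ-≡; *-comm; *-distribˡ-+; *-identityʳ; *-identityˡ; *-monoʳ-≤;
         *-zeroʳ; +-cancelʳ-≡; +-cancelʳ-≤; +-cancelˡ-≤; +-comm; +-identityʳ; +-mono-≤;
         +-monoʳ-≤; +-monoˡ-≤; +-suc; <-asym; <-irrelevant; <⇒≢; <⇒≤; m≤m+n; m≤n+m; n≤1+n;
         suc-injective; ≤-antisym; ≤-refl; ≤-reflexive; ≤-total; ≤-trans; ≤∧≢⇒<; ≰⇒>;
         ⌊n/2⌋+⌈n/2⌉≡n; ⌊n/2⌋-mono; module ≤-Reasoning; _≟_; _≤?_; _<?_;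
         +-commutativeSemigroup)
open import Data.Product.Base using (Σ; ∃-syntax; _×_; _,_; proj₁; proj₂)
open import Data.Sum.Base using (_⊎_; inj₁; inj₂)
open import Function.Base using (_∘_)
open import Function.Bundles using (_⇔_; mk⇔)
open import Level using (Level; 0ℓ)
open import Relation.Binary.Bundles using (DecSetoid)
open import Relation.Binary.Definitions using (tri<; tri≈; tri>)
open import Relation.Binary.PropositionalEquality
  using (_≡_; _≢_; refl; sym; trans; cong; cong₂; subst; subst₂; module ≡-Reasoning)
open import Relation.Nullary.Decidable
  using (Dec; yes; no; does; map′; dec-true; dec-false; _×-dec_; _⊎-dec_; _→-dec_)
open import Relation.Nullary.Negation using (¬_; contradiction)

open CommutativeSemigroupProperties +-commutativeSemigroup using (interchange)

-- For n ≥ 3 the bound is at least 1, which the comparison of edge numbers requires.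
--
-- A permutation is a record of functions and proofs, so without function extensionality two
-- permutations with the same values need not be propositionally equal. Sums over permutations are
-- therefore not reindexed along functions: bijections, and the maps with fibres of size |Aut A|,
-- are decidable relations whose fibres are counted.
--
-- Isomorphism invariance shown directly on the index set of M_G would require re-sorting the
-- increasing sequences. It is derived instead from the invariance of the numbers of embeddings, by
-- cancelling |Aut A|. Characteristic 0 lets equal values in the field be read as equal numbers of
-- copies.

private variable
  ℓ ℓ′ : Level
  A B : Set ℓ
  X : Set ℓ
  Y : Set ℓ′
  m n : ℕ

-- Counting over lists

⟦_⟧ : Dec X → ℕ
⟦ X? ⟧ = if does X? then 1 else 0

⟦⟧-true : (X? : Dec X) → X → ⟦ X? ⟧ ≡ 1
⟦⟧-true (yes _) _ = refl
⟦⟧-true (no ¬p) p = contradiction p ¬p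

⟦⟧-false : (X? : Dec X) → ¬ X → ⟦ X? ⟧ ≡ 0
⟦⟧-false (yes p) ¬p = contradiction p ¬p
⟦⟧-false (no _)  _  = refl

⟦⟧-cong : (X? : Dec X) (Y? : Dec Y) → (X → Y) → (Y → X) → ⟦ X? ⟧ ≡ ⟦ Y? ⟧
⟦⟧-cong (yes p) Y? f g = sym (⟦⟧-true Y? (f p))
⟦⟧-cong (no ¬p) Y? f g = sym (⟦⟧-false Y? (¬p ∘ g))

⟦⟧-positive : (X? : Dec X) → 0 < ⟦ X? ⟧ → X
⟦⟧-positive (yes p) _ = p

sumOver : List A → (A → ℕ) → ℕ
sumOver xs f = sum (map f xs)

sumOver-cong : ∀ (xs : List A) {f g : A → ℕ} → (∀ {x} → x ∈ xs → f x ≡ g x) →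
               sumOver xs f ≡ sumOver xs g
sumOver-cong []       f≗g = refl
sumOver-cong (x ∷ xs) f≗g = cong₂ _+_ (f≗g (here refl)) (sumOver-cong xs (f≗g ∘ there))

sumOver-mono : ∀ (xs : List A) {f g : A → ℕ} → (∀ x → f x ≤ g x) →
               sumOver xs f ≤ sumOver xs g
sumOver-mono []       f≤g = z≤n
sumOver-mono (x ∷ xs) f≤g = +-mono-≤ (f≤g x) (sumOver-mono xs f≤g)

sumOver-zero : (xs : List A) → sumOver xs (λ _ → 0) ≡ 0
sumOver-zero []       = refl
sumOver-zero (_ ∷ xs) = sumOver-zero xs

sumOver-+ : ∀ (xs : List A) (f g : A → ℕ) →
            sumOver xs (λ x → f x + g x) ≡ sumOver xs f + sumOver xs g
sumOver-+ []       f g = refl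
sumOver-+ (x ∷ xs) f g =
  trans (cong (f x + g x +_) (sumOver-+ xs f g)) (interchange (f x) (g x) _ _)

sumOver-*ˡ : ∀ k (xs : List A) (f : A → ℕ) → sumOver xs (λ x → k * f x) ≡ k * sumOver xs f
sumOver-*ˡ k []       f = sym (*-zeroʳ k)
sumOver-*ˡ k (x ∷ xs) f =
  trans (cong (k * f x +_) (sumOver-*ˡ k xs f)) (sym (*-distribˡ-+ k (f x) _))

sumOver-swap : ∀ (xs : List A) (ys : List B) (f : A → B → ℕ) →
               sumOver xs (λ x → sumOver ys (f x)) ≡ sumOver ys (λ y → sumOver xs (λ x → f x y))
sumOver-swap []       ys f = sym (sumOver-zero ys)
sumOver-swap (x ∷ xs) ys f =
  trans (cong (sumOver ys (f x) +_) (sumOver-swap xs ys f)) (sym (sumOver-+ ys (f x) _))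

sumOver-concatMap : ∀ (xs : List A) (g : A → List B) (f : B → ℕ) →
                    sumOver (concatMap g xs) f ≡ sumOver xs (λ x → sumOver (g x) f)
sumOver-concatMap []       g f = refl
sumOver-concatMap (x ∷ xs) g f = begin
  sumOver (g x ++ concatMap g xs) f           ≡⟨ cong sum (map-++ f (g x) (concatMap g xs)) ⟩
  sum (map f (g x) ++ map f (concatMap g xs)) ≡⟨ sum-++ (map f (g x)) _ ⟩
  sumOver (g x) f + sumOver (concatMap g xs) f ≡⟨ cong (sumOver (g x) f +_) (sumOver-concatMap xs g f) ⟩
  sumOver (g x) f + sumOver xs (λ x → sumOver (g x) f) ∎
  where open ≡-Reasoning

sumOver-map : ∀ (xs : List A) (g : A → B) (f : B → ℕ) → sumOver (map g xs) f ≡ sumOver xs (f ∘ g)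
sumOver-map xs g f = cong sum (sym (map-∘ xs))

sumOver-positive : ∀ (xs : List A) (f : A → ℕ) → 0 < sumOver xs f → ∃[ x ] x ∈ xs × 0 < f x
sumOver-positive (x ∷ xs) f 0<∑ with f x in eq
... | suc _ = x , here refl , subst (0 <_) (sym eq) z<s
... | zero  = let y , y∈ , 0<fy = sumOver-positive xs f 0<∑ in y , there y∈ , 0<fy

∈⇒≤sumOver : ∀ {xs : List A} (f : A → ℕ) {x} → x ∈ xs → f x ≤ sumOver xs f
∈⇒≤sumOver f (here refl) = m≤m+n _ _
∈⇒≤sumOver f (there x∈)  = ≤-trans (∈⇒≤sumOver f x∈) (m≤n+m _ _)

-- A strict inequality at one entry could not be made up at the others. This is what turns an
-- inclusion of edge sets of equal size into an equality.
sumOver-≡⇒≗ : ∀ (xs : List A) {f g : A → ℕ} → (∀ x → f x ≤ g x) →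
              sumOver xs g ≤ sumOver xs f → ∀ {x} → x ∈ xs → f x ≡ g x
sumOver-≡⇒≗ (x ∷ xs) {f} {g} f≤g ∑g≤∑f x∈ = go x∈
  where
  go : ∀ {y} → y ∈ x ∷ xs → f y ≡ g y
  go (here refl) = ≤-antisym (f≤g x) (+-cancelʳ-≤ (sumOver xs f) (g x) (f x)
    (≤-trans (+-monoʳ-≤ (g x) (sumOver-mono xs f≤g)) ∑g≤∑f))
  go (there y∈) = sumOver-≡⇒≗ xs f≤g (+-cancelˡ-≤ (f x) _ _
    (≤-trans (+-monoˡ-≤ (sumOver xs g) (f≤g x)) ∑g≤∑f)) y∈

module _ {P : A → Set ℓ} (P? : ∀ x → Dec (P x)) where

  sumOver-none : ∀ xs → (∀ {x} → x ∈ xs → ¬ P x) → sumOver xs (λ x → ⟦ P? x ⟧) ≡ 0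
  sumOver-none xs ¬P =
    trans (sumOver-cong xs (λ {x} x∈ → ⟦⟧-false (P? x) (¬P x∈))) (sumOver-zero xs)

  sumOver-≤1 : ∀ {xs} → Unique xs → (∀ {x y} → P x → P y → x ≡ y) →
               sumOver xs (λ x → ⟦ P? x ⟧) ≤ 1
  sumOver-≤1 []         P! = z≤n
  sumOver-≤1 {x ∷ xs} (x∉ ∷ xs!) P! with P? x
  ... | yes Px = ≤-reflexive
    (cong suc (sumOver-none xs (λ y∈ Py → All.lookup x∉ y∈ (P! Px Py))))
  ... | no  _  = sumOver-≤1 xs! P!

  sumOver-≡1 : ∀ {xs} → Unique xs → ∀ {x} → x ∈ xs → P x → (∀ {x y} → P x → P y → x ≡ y) →
               sumOver xs (λ x → ⟦ P? x ⟧) ≡ 1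
  sumOver-≡1 {xs} xs! {x} x∈ Px P! = ≤-antisym (sumOver-≤1 xs! P!)
    (subst (_≤ sumOver xs (λ x → ⟦ P? x ⟧)) (⟦⟧-true (P? x) Px) (∈⇒≤sumOver _ x∈))

-- Double counting

module _ {R : A → B → Set ℓ} (R? : ∀ x y → Dec (R x y)) (xs : List A) (ys : List B)
         {f : A → ℕ} {g : B → ℕ} (f≡g : ∀ {x y} → R x y → f x ≡ g y)
         (unique : ∀ {x} → x ∈ xs → sumOver ys (λ y → ⟦ R? x y ⟧) ≡ 1) where

  private
    f*⟦⟧≡g*⟦⟧ : ∀ x y → f x * ⟦ R? x y ⟧ ≡ g y * ⟦ R? x y ⟧
    f*⟦⟧≡g*⟦⟧ x y with R? x y
    ... | yes r = cong (_* 1) (f≡g r)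
    ... | no  _ = trans (*-zeroʳ (f x)) (sym (*-zeroʳ (g y)))

  -- Each `x` is related to exactly one `y`, so `f x` may be spread over its incidences with `R`;
  -- there it equals `g y`, and the two sums are exchanged.
  doubleCounting : sumOver xs f ≡ sumOver ys (λ y → g y * sumOver xs (λ x → ⟦ R? x y ⟧))
  doubleCounting = begin
    sumOver xs f
      ≡⟨ sumOver-cong xs (λ {x} x∈ → sym (trans (cong (f x *_) (unique x∈)) (*-identityʳ (f x)))) ⟩
    sumOver xs (λ x → f x * sumOver ys (λ y → ⟦ R? x y ⟧))
      ≡⟨ sumOver-cong xs (λ {x} _ → sym (sumOver-*ˡ (f x) ys _)) ⟩
    sumOver xs (λ x → sumOver ys (λ y → f x * ⟦ R? x y ⟧))
      ≡⟨ sumOver-cong xs (λ {x} _ → sumOver-cong ys (λ {y} _ → f*⟦⟧≡g*⟦⟧ x y)) ⟩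
    sumOver xs (λ x → sumOver ys (λ y → g y * ⟦ R? x y ⟧))
      ≡⟨ sumOver-swap xs ys _ ⟩
    sumOver ys (λ y → sumOver xs (λ x → g y * ⟦ R? x y ⟧))
      ≡⟨ sumOver-cong ys (λ {y} _ → sumOver-*ˡ (g y) xs _) ⟩
    sumOver ys (λ y → g y * sumOver xs (λ x → ⟦ R? x y ⟧)) ∎
    where open ≡-Reasoning

  -- Replaces reindexing along a k-to-one map. It is used with k = 1 for bijections, and with k =
  -- |Aut A| to pass from permutations to copies.
  sumOver-fibres : ∀ k → (∀ {y} → y ∈ ys → sumOver xs (λ x → ⟦ R? x y ⟧) ≡ k) →
                   sumOver xs f ≡ k * sumOver ys g
  sumOver-fibres k fibre≡k = begin
    sumOver xs f ≡⟨ doubleCounting ⟩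
    sumOver ys (λ y → g y * sumOver xs (λ x → ⟦ R? x y ⟧))
      ≡⟨ sumOver-cong ys (λ {y} y∈ → trans (cong (g y *_) (fibre≡k y∈)) (*-comm (g y) k)) ⟩
    sumOver ys (λ y → k * g y) ≡⟨ sumOver-*ˡ k ys g ⟩
    k * sumOver ys g ∎
    where open ≡-Reasoning

  sumOver-injection : (∀ y → sumOver xs (λ x → ⟦ R? x y ⟧) ≤ 1) → sumOver xs f ≤ sumOver ys g
  sumOver-injection fibre≤1 = begin
    sumOver xs f ≡⟨ doubleCounting ⟩
    sumOver ys (λ y → g y * sumOver xs (λ x → ⟦ R? x y ⟧))
      ≤⟨ sumOver-mono ys (λ y →
           ≤-trans (*-monoʳ-≤ (g y) (fibre≤1 y)) (≤-reflexive (*-identityʳ (g y)))) ⟩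
    sumOver ys g ∎
    where open ≤-Reasoning

-- Permutations

infix 4 _≈?_ _≟ₚ_

-- Decision procedures used only through ⟦_⟧ are abstract, to keep them from
-- being unfolded during type checking.
abstract
  _≈?_ : (π ρ : Permutation′ n) → Dec (π Perm.≈ ρ)
  π ≈? ρ = Fin.all? (λ i → π ⟨$⟩ʳ i Fin.≟ ρ ⟨$⟩ʳ i)

insert≈⇒≈remove : ∀ j (ρ : Permutation′ n) (σ : Permutation′ (suc n)) →
                  insert zero j ρ Perm.≈ σ → j ≡ σ ⟨$⟩ʳ zero × ρ Perm.≈ remove zero σ
insert≈⇒≈remove j ρ σ ρ≈σ = ρ≈σ zero , λ i → Fin.punchIn-injective j _ _ (begin
  punchIn j (ρ ⟨$⟩ʳ i)                              ≡⟨ insert-punchIn zero j ρ i ⟨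
  insert zero j ρ ⟨$⟩ʳ suc i                         ≡⟨ ρ≈σ (suc i) ⟩
  σ ⟨$⟩ʳ suc i                                       ≡⟨ punchIn-permute σ zero i ⟩
  punchIn (σ ⟨$⟩ʳ zero) (remove zero σ ⟨$⟩ʳ i)        ≡⟨ cong (λ j → punchIn j _) (ρ≈σ zero) ⟨
  punchIn j (remove zero σ ⟨$⟩ʳ i)                   ∎)
  where open ≡-Reasoning

≈remove⇒insert≈ : ∀ j (ρ : Permutation′ n) (σ : Permutation′ (suc n)) →
                  j ≡ σ ⟨$⟩ʳ zero → ρ Perm.≈ remove zero σ → insert zero j ρ Perm.≈ σ
≈remove⇒insert≈ j ρ σ j≡ ρ≈ zero    = j≡
≈remove⇒insert≈ j ρ σ refl ρ≈ (suc i) = begin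
  insert zero j ρ ⟨$⟩ʳ suc i        ≡⟨ insert-punchIn zero j ρ i ⟩
  punchIn j (ρ ⟨$⟩ʳ i)              ≡⟨ cong (punchIn j) (ρ≈ i) ⟩
  punchIn j (remove zero σ ⟨$⟩ʳ i)  ≡⟨ punchIn-permute σ zero i ⟨
  σ ⟨$⟩ʳ suc i                      ∎
  where open ≡-Reasoning

perms : ∀ n → List (Permutation′ n)
perms zero    = [ Perm.id ]
perms (suc n) = concatMap (λ j → map (insert zero j) (perms n)) (allFin (suc n))

-- Counting the matches expresses at once that `perms n` is exhaustive and free of repetitions up to
-- pointwise equality. A matching entry `insert zero j ρ` must have `j = σ zero`, and `ρ` must match
-- `remove zero σ`, which is the induction.
perms-enumerate : (σ : Permutation′ n) → sumOver (perms n) (λ ρ → ⟦ ρ ≈? σ ⟧) ≡ 1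
perms-enumerate {zero}  σ = cong (_+ 0) (⟦⟧-true (Perm.id ≈? σ) λ ())
perms-enumerate {suc n} σ = begin
  sumOver (perms (suc n)) (λ ρ → ⟦ ρ ≈? σ ⟧)
    ≡⟨ sumOver-concatMap (allFin (suc n)) (λ j → map (insert zero j) (perms n)) (λ ρ → ⟦ ρ ≈? σ ⟧) ⟩
  sumOver (allFin (suc n)) (λ j → sumOver (map (insert zero j) (perms n)) (λ ρ → ⟦ ρ ≈? σ ⟧))
    ≡⟨ sumOver-cong (allFin (suc n)) (λ {j} _ →
         trans (sumOver-map (perms n) (insert zero j) (λ ρ → ⟦ ρ ≈? σ ⟧)) (inner j)) ⟩
  sumOver (allFin (suc n)) (λ j → ⟦ j Fin.≟ σ ⟨$⟩ʳ zero ⟧)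
    ≡⟨ sumOver-≡1 (λ j → j Fin.≟ σ ⟨$⟩ʳ zero) (Unique.allFin⁺ (suc n)) (∈-allFin _) refl
         (λ j≡ k≡ → trans j≡ (sym k≡)) ⟩
  1 ∎
  where
  open ≡-Reasoning
  inner : ∀ j → sumOver (perms n) (λ ρ → ⟦ insert zero j ρ ≈? σ ⟧) ≡ ⟦ j Fin.≟ σ ⟨$⟩ʳ zero ⟧
  inner j with j Fin.≟ σ ⟨$⟩ʳ zero
  ... | no  j≢ = sumOver-none (λ ρ → insert zero j ρ ≈? σ) (perms n) λ {ρ} _ →
    j≢ ∘ proj₁ ∘ insert≈⇒≈remove j ρ σ
  ... | yes j≡ = trans
    (sumOver-cong (perms n) λ {ρ} _ → ⟦⟧-cong (insert zero j ρ ≈? σ) (ρ ≈? remove zero σ)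
      (proj₂ ∘ insert≈⇒≈remove j ρ σ) (≈remove⇒insert≈ j ρ σ j≡))
    (perms-enumerate (remove zero σ))

perms-complete : (σ : Permutation′ n) → ∃[ ρ ] ρ ∈ perms n × ρ Perm.≈ σ
perms-complete {n} σ =
  let ρ , ρ∈ , 0< = sumOver-positive (perms n) (λ ρ → ⟦ ρ ≈? σ ⟧)
                      (≤-reflexive (sym (perms-enumerate σ)))
  in ρ , ρ∈ , ⟦⟧-positive (ρ ≈? σ) 0<

-- Following `σ` by `τ` is a bijection of the symmetric group, with inverse given by `flip τ`.
sumOver-translate : ∀ (τ : Permutation′ n) {f g : Permutation′ n → ℕ} →
                    (∀ {ρ σ} → ρ Perm.≈ (σ ∘ₚ τ) → f ρ ≡ g σ) →
                    sumOver (perms n) f ≡ sumOver (perms n) g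
sumOver-translate {n} τ {f} {g} f≡g = trans
  (sumOver-fibres (λ ρ σ → ρ ≈? (σ ∘ₚ τ)) (perms n) (perms n) f≡g
    (λ {ρ} _ → trans
      (sumOver-cong (perms n) λ {σ} _ → ⟦⟧-cong (ρ ≈? (σ ∘ₚ τ)) (σ ≈? (ρ ∘ₚ flip τ))
        (λ ρ≈ i → sym (trans (cong (τ ⟨$⟩ˡ_) (ρ≈ i)) (inverseˡ τ)))
        (λ σ≈ i → sym (trans (cong (τ ⟨$⟩ʳ_) (σ≈ i)) (inverseʳ τ))))
      (perms-enumerate (ρ ∘ₚ flip τ)))
    1 (λ {σ} _ → perms-enumerate (σ ∘ₚ τ)))
  (*-identityˡ _)

transpose-first : ∀ (i j : Fin n) → transpose i j ⟨$⟩ʳ i ≡ j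
transpose-first i j rewrite dec-true (i Fin.≟ i) refl = refl

transpose-other : ∀ (i j : Fin n) {k} → k ≢ i → k ≢ j → transpose i j ⟨$⟩ʳ k ≡ k
transpose-other i j {k} k≢i k≢j
  rewrite dec-false (k Fin.≟ i) k≢i | dec-false (k Fin.≟ j) k≢j = refl

Injective : {A : Set} → (Fin m → A) → Set
Injective f = ∀ {i j} → f i ≡ f j → i ≡ j

-- An injection between subsets of a finite set extends to a permutation; the prescribed values are
-- corrected one at a time by transpositions.
extend : ∀ {m} (e f : Fin m → Fin n) → Injective e → Injective f →
         ∃[ τ ] (∀ i → τ ⟨$⟩ʳ e i ≡ f i)
extend {m = zero}  e f e-inj f-inj = Perm.id , λ ()
extend {m = suc m} e f e-inj f-inj
  with τ , τe≡f ← extend (e ∘ suc) (f ∘ suc) (Fin.suc-injective ∘ e-inj) (Fin.suc-injective ∘ f-inj)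
  -- The transposition moves the current image of `e zero` to `f zero`. The values `f (suc i)`
  -- already attained differ from both points, by injectivity of `e` and of `f`, and stay in place.
  = τ ∘ₚ transpose (τ ⟨$⟩ʳ e zero) (f zero) , λ
  { zero    → transpose-first (τ ⟨$⟩ʳ e zero) (f zero)
  ; (suc i) → trans
      (transpose-other (τ ⟨$⟩ʳ e zero) (f zero)
        (λ eq → Fin.0≢1+n (sym (e-inj (⟨$⟩ʳ-injective τ eq))))
        (λ eq → Fin.0≢1+n (sym (f-inj (trans (sym (τe≡f i)) eq)))))
      (τe≡f i)
  }

minimum : (f : Fin (suc m) → ℕ) → ∃[ k ] (∀ i → f k ≤ f i)
minimum {zero}  f = zero , λ { zero → ≤-refl }
minimum {suc m} f with minimum (f ∘ suc)
... | k , min with ≤-total (f zero) (f (suc k))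
...   | inj₁ ≤k = zero , λ { zero → ≤-refl ; (suc i) → ≤-trans ≤k (min i) }
...   | inj₂ k≤ = suc k , λ { zero → k≤ ; (suc i) → min i }

-- Selection sort: the minimum becomes the head and the new lower bound, which is strict for the
-- remaining values because `f` is injective. `π` records where each value came from.
sort : ∀ lo (f : Fin m → ℕ) → Injective f → (∀ i → lo < f i) →
       Σ (Increasing lo m) λ r → Σ (Permutation′ m) λ π → ∀ k → r ‼ k ≡ f (π ⟨$⟩ʳ k)
sort {zero}  lo f f-inj lo<f = [] , Perm.id , λ ()
sort {suc m} lo f f-inj lo<f
  with k , min ← minimum f
  with r , π , r≡ ← sort (f k) (f ∘ punchIn k) (Fin.punchIn-injective k _ _ ∘ f-inj)
         (λ i → ≤∧≢⇒< (min _) (λ eq → Fin.punchInᵢ≢i k i (sym (f-inj eq))))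
  = (f k ∷⟨ lo<f k ⟩ r) , insert zero k π , λ
  { zero    → refl
  ; (suc i) → trans (r≡ i) (cong f (sym (insert-punchIn zero k π i)))
  }

-- Increasing sequences, pairs and families

SameImage : ∀ {lo lo′} → Increasing lo m → Increasing lo′ m → Set
SameImage r s = (∀ k → ∃[ l ] r ‼ k ≡ s ‼ l) × (∀ k → ∃[ l ] s ‼ k ≡ r ‼ l)

‼-zero-least : ∀ {lo} (r : Increasing lo (suc m)) k → r ‼ zero ≤ r ‼ k
‼-zero-least r zero    = ≤-refl
‼-zero-least r (suc k) = <⇒≤ (‼-mono r z<s)

-- The heads are the least elements of the same set. Every later entry exceeds the head, so the
-- tails again have the same image.
sameImage⇒≡ : ∀ {lo} {r s : Increasing lo m} → SameImage r s → r ≡ s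
sameImage⇒≡ {r = []}                {[]}             _         = refl
sameImage⇒≡ {r = r@(x ∷⟨ lo<x ⟩ r′)} {s@(y ∷⟨ lo<y ⟩ s′)} (r⊆s , s⊆r) with x≡y
  where
  x≡y : x ≡ y
  x≡y = ≤-antisym
    (let k , y≡ = s⊆r zero in subst (x ≤_) (sym y≡) (‼-zero-least r k))
    (let k , x≡ = r⊆s zero in subst (y ≤_) (sym x≡) (‼-zero-least s k))
... | refl = cong₂ (x ∷⟨_⟩_) (<-irrelevant lo<x lo<y)
  (sameImage⇒≡ (tail r′ s′ r⊆s , tail s′ r′ s⊆r))
  where
  tail : ∀ (t u : Increasing x _) {p q} →
         (∀ k → ∃[ l ] (_∷⟨_⟩_ {lo = _} x p t) ‼ k ≡ (_∷⟨_⟩_ {lo = _} x q u) ‼ l) →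
         ∀ k → ∃[ l ] t ‼ k ≡ u ‼ l
  tail t u t⊆u k with t⊆u (suc k)
  ... | zero  , t≡x = contradiction (sym t≡x) (<⇒≢ (‼-lower t k))
  ... | suc l , t≡u = l , t≡u

‼-injective : ∀ {lo} (r : Increasing lo m) → Injective (r ‼_)
‼-injective r {i} {j} eq with Fin.<-cmp i j
... | tri< i<j _ _ = contradiction eq (<⇒≢ (‼-mono r i<j))
... | tri≈ _ i≡j _ = i≡j
... | tri> _ _ j<i = contradiction (sym eq) (<⇒≢ (‼-mono r j<i))

pair-≡ : {p q : Pair n} → Pair.fst p ≡ Pair.fst q → Pair.snd p ≡ Pair.snd q → p ≡ q
pair-≡ {p = pair i j p} {pair .i .j q} refl refl = cong (pair i j) (<-irrelevant p q)

_≟ₚ_ : (p q : Pair n) → Dec (p ≡ q)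
p ≟ₚ q with Pair.fst p Fin.≟ Pair.fst q | Pair.snd p Fin.≟ Pair.snd q
... | yes f | yes s = yes (pair-≡ f s)
... | no ¬f | _     = no (¬f ∘ cong Pair.fst)
... | yes _ | no ¬s = no (¬s ∘ cong Pair.snd)

∈-pairsFrom⁻ : ∀ {ij : Fin n × Fin n} {p} → p ∈ pairsFrom ij → ij ≡ (Pair.fst p , Pair.snd p)
∈-pairsFrom⁻ {ij = i , j} p∈ with i Fin.<? j
∈-pairsFrom⁻ (here refl) | yes _ = refl

pairs-unique : ∀ n → Unique (pairs n)
pairs-unique n = Unique.concat⁺
  (All.map⁺ (All.universal unique (cartesianProduct (allFin n) (allFin n))))
  (AllPairs.map⁺ (AllPairs.map disjoint
    (Unique.cartesianProduct⁺ (Unique.allFin⁺ n) (Unique.allFin⁺ n))))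
  where
  unique : (ij : Fin n × Fin n) → Unique (pairsFrom ij)
  unique (i , j) with i Fin.<? j
  ... | yes _ = [] ∷ []
  ... | no  _ = []
  disjoint : ∀ {ij kl : Fin n × Fin n} → ij ≢ kl → Disjoint (pairsFrom ij) (pairsFrom kl)
  disjoint ij≢kl (p∈ , p∈′) = ij≢kl (trans (∈-pairsFrom⁻ p∈) (sym (∈-pairsFrom⁻ p∈′)))

-- The unordered reading of a pair. It is preserved by every permutation, so the comparison hidden
-- in `_·_` need not be repeated in each argument.
Endpoints : (p : Pair n) (i j : Fin n) → Set
Endpoints p i j = (Pair.fst p ≡ i × Pair.snd p ≡ j) ⊎ (Pair.fst p ≡ j × Pair.snd p ≡ i)

·-endpoints : ∀ (σ : Permutation′ n) p →
              Endpoints (σ · p) (σ ⟨$⟩ʳ Pair.fst p) (σ ⟨$⟩ʳ Pair.snd p)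
·-endpoints σ (pair i j i<j) with Fin.<-cmp (σ ⟨$⟩ʳ i) (σ ⟨$⟩ʳ j)
... | tri< _ _ _   = inj₁ (refl , refl)
... | tri> _ _ _   = inj₂ (refl , refl)
... | tri≈ _ eq _  = contradiction (⟨$⟩ʳ-injective σ eq) (Fin.<⇒≢ i<j)

endpoints-unique : ∀ {p q : Pair n} {i j} → Endpoints p i j → Endpoints q i j → p ≡ q
endpoints-unique                  (inj₁ (refl , refl)) (inj₁ (f , s)) = pair-≡ (sym f) (sym s)
endpoints-unique                  (inj₂ (refl , refl)) (inj₂ (f , s)) = pair-≡ (sym f) (sym s)
endpoints-unique {p = p} {q = q} (inj₁ (refl , refl)) (inj₂ (f , s)) =
  contradiction (Pair.fst<snd q) (<-asym (subst₂ Fin._<_ (sym s) (sym f) (Pair.fst<snd p)))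
endpoints-unique {p = p} {q = q} (inj₂ (refl , refl)) (inj₁ (f , s)) =
  contradiction (Pair.fst<snd q) (<-asym (subst₂ Fin._<_ (sym s) (sym f) (Pair.fst<snd p)))

endpoints-map : ∀ {p : Pair n} {i j} (σ : Permutation′ n) → Endpoints p i j →
                Endpoints (σ · p) (σ ⟨$⟩ʳ i) (σ ⟨$⟩ʳ j)
endpoints-map {p = p} σ (inj₁ (refl , refl)) = ·-endpoints σ p
endpoints-map {p = p} σ (inj₂ (refl , refl)) with ·-endpoints σ p
... | inj₁ e = inj₂ e
... | inj₂ e = inj₁ e

·-inverse : ∀ (σ τ : Permutation′ n) → (∀ i → τ ⟨$⟩ʳ (σ ⟨$⟩ʳ i) ≡ i) → ∀ p → τ · σ · p ≡ p
·-inverse σ τ τσ≡id p = endpoints-unique {i = Pair.fst p} {Pair.snd p}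
  (subst₂ (Endpoints (τ · σ · p)) (τσ≡id _) (τσ≡id _) (endpoints-map τ (·-endpoints σ p)))
  (inj₁ (refl , refl))

sumOver-· : ∀ (σ : Permutation′ n) (f : Pair n → ℕ) →
            sumOver (pairs n) (λ p → f (σ · p)) ≡ sumOver (pairs n) f
sumOver-· {n} σ f = trans
  (sumOver-fibres (λ p q → σ · p ≟ₚ q) (pairs n) (pairs n) {g = f} (λ { refl → refl })
    (λ {p} _ → sumOver-≡1 (σ · p ≟ₚ_) (pairs-unique n) (pair∈pairs _) refl
       (λ eq eq′ → trans (sym eq) eq′))
    1 (λ {q} _ → sumOver-≡1 (λ p → σ · p ≟ₚ q) (pairs-unique n) (pair∈pairs (flip σ · q))
       (·-inverse (flip σ) σ (λ _ → inverseʳ σ) q)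
       (λ {p} {p′} eq eq′ → trans (sym (·-inverse σ (flip σ) (λ _ → inverseˡ σ) p))
         (trans (cong (flip σ ·_) (trans eq (sym eq′))) (·-inverse σ (flip σ) (λ _ → inverseˡ σ) p′)))))
  (*-identityˡ _)

adjₚ : Graph n → Pair n → Bool
adjₚ G (pair i j _) = adj G i j

adjₚ-endpoints : ∀ (G : Graph n) {p i j} → Endpoints p i j → adjₚ G p ≡ adj G i j
adjₚ-endpoints G (inj₁ (refl , refl)) = refl
adjₚ-endpoints G (inj₂ (refl , refl)) = adj-sym G _ _

adjₚ-· : ∀ (G : Graph n) σ p → adjₚ G (σ · p) ≡ adj G (σ ⟨$⟩ʳ Pair.fst p) (σ ⟨$⟩ʳ Pair.snd p)
adjₚ-· G σ p = adjₚ-endpoints G {σ · p} (·-endpoints σ p)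

bit : Bool → ℕ
bit x = if x then 1 else 0

bit-injective : ∀ {x y} → bit x ≡ bit y → x ≡ y
bit-injective {false} {false} _ = refl
bit-injective {true}  {true}  _ = refl

-- Stated for a relation `R` because it serves both for vertices up to equality and for permutations
-- up to `SameFamily`.
lookup-injective : ∀ {A : Set} {R : A → A → Set} → (∀ {x y} → R x y → R y x) →
                   ∀ {xs} → AllPairs (λ x y → ¬ R x y) xs → ∀ {s t} →
                   R (lookup xs s) (lookup xs t) → s ≡ t
lookup-injective R-sym (x∉ ∷ xs!) {zero}  {zero}  r = refl
lookup-injective R-sym (x∉ ∷ xs!) {zero}  {suc t} r = contradiction r (All.lookup x∉ (∈-lookup t))
lookup-injective R-sym (x∉ ∷ xs!) {suc s} {zero}  r =
  contradiction (R-sym r) (All.lookup x∉ (∈-lookup s))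
lookup-injective R-sym (x∉ ∷ xs!) {suc s} {suc t} r = cong suc (lookup-injective R-sym xs! r)

module _ {m} (G : Graph m) where

  SameFamily : (σ τ : Permutation′ m) → Set
  SameFamily σ τ = ∀ p → a G (σ · p) ≡ a G (τ · p)

  sameFamily-decSetoid : DecSetoid 0ℓ 0ℓ
  sameFamily-decSetoid = record
    { Carrier = Permutation′ m
    ; _≈_ = SameFamily
    ; isDecEquivalence = record
      { isEquivalence = record
        { refl  = λ _ → refl
        ; sym   = λ e p → sym (e p)
        ; trans = λ e f p → trans (e p) (f p)
        }
      ; _≟_ = λ σ τ → map′ (λ all p → All.lookup all (pair∈pairs p)) (λ f → All.universal f _)
                        (All.all? (λ p → a G (σ · p) ≟ a G (τ · p)) (pairs m))
      }
    }

  open DecSetoid sameFamily-decSetoid using () renaming (_≟_ to _≟ₐ_)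

  a-· : ∀ σ p → a G (σ · p) ≡ bit (adj G (σ ⟨$⟩ʳ Pair.fst p) (σ ⟨$⟩ʳ Pair.snd p))
  a-· σ p = cong bit (adjₚ-· G σ p)

  ≈⇒sameFamily : ∀ {σ τ} → σ Perm.≈ τ → SameFamily σ τ
  ≈⇒sameFamily {σ} {τ} σ≈τ p = trans (a-· σ p)
    (trans (cong₂ (λ i j → bit (adj G i j)) (σ≈τ _) (σ≈τ _)) (sym (a-· τ p)))

  sameFamily⇒adj : ∀ {σ τ} → SameFamily σ τ → ∀ i j →
                   adj G (σ ⟨$⟩ʳ i) (σ ⟨$⟩ʳ j) ≡ adj G (τ ⟨$⟩ʳ i) (τ ⟨$⟩ʳ j)
  sameFamily⇒adj {σ} {τ} same i j with Fin.<-cmp i j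
  ... | tri< i<j _ _  =
    bit-injective (trans (sym (a-· σ (pair i j i<j))) (trans (same _) (a-· τ (pair i j i<j))))
  ... | tri≈ _ refl _ = trans (adj-irrefl G _) (sym (adj-irrefl G _))
  ... | tri> _ _ j<i  = trans (adj-sym G _ _) (trans
    (bit-injective (trans (sym (a-· σ (pair j i j<i))) (trans (same _) (a-· τ (pair j i j<i)))))
    (adj-sym G _ _))

  private
    reps : List (Permutation′ m)
    reps = deduplicate _≟ₐ_ (perms m)

  -- Conditions (ii) and (iii) quantify over the choice of `R`; using them as hypotheses takes an
  -- actual choice for each `G`.
  representatives : Representatives G
  representatives = record
    { size     = length reps
    ; perm     = lookup reps
    ; distinct = λ _ _ → lookup-injective (λ e p → sym (e p))
        (UniqueDec.deduplicate-! sameFamily-decSetoid (perms m))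
    ; exhaust  = λ σ →
        let ρ , ρ∈ , ρ≈σ = perms-complete σ
            σ~ = Any.deduplicate⁺ _≟ₐ_ {P = SameFamily σ}
                   (λ ρ~τ σ~τ p → trans (σ~τ p) (sym (ρ~τ p)))
                   (Any.map (λ { refl p → sym (≈⇒sameFamily ρ≈σ p) }) ρ∈)
        in Any.index σ~ , Any.lookup-index σ~
    }

-- Copies of a graph

label : Fin n → ℕ
label u = suc (toℕ u)

label-injective : Injective (label {n})
label-injective = Fin.toℕ-injective ∘ suc-injective

label-surjective : ∀ {x} → 0 < x → x ≤ n → ∃[ u ] label {n} u ≡ x
label-surjective {x = suc x} _ x<n = fromℕ< x<n , cong suc (Fin.toℕ-fromℕ< x<n)

true-ext : ∀ {x y} → (x ≡ true → y ≡ true) → (y ≡ true → x ≡ true) → x ≡ y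
true-ext {true}  {true}  f g = refl
true-ext {true}  {false} f g = sym (f refl)
true-ext {false} {true}  f g = g refl
true-ext {false} {false} f g = refl

bounded-sound : ∀ {lo} (r : Increasing lo m) → r ∈ bounded n lo m → Bounded n r
bounded-sound {m = suc m} {n} {lo} r r∈ k
  with x , x∈ , r∈x ← find (∈-concatMap⁻ (boundedFrom n lo m) {xs = upTo (suc n)} r∈)
  with lo <? x
... | yes lo<x with ∈-map⁻ (x ∷⟨ lo<x ⟩_) r∈x
bounded-sound _ _ zero    | yes lo<x | _ , _  , refl = s≤s⁻¹ (∈-upTo⁻ x∈)
bounded-sound _ _ (suc k) | yes lo<x | t , t∈ , refl = bounded-sound t t∈ k

module _ (A H : Graph n) where

  Embeds : Permutation′ n → Set
  Embeds σ = ∀ u v → adj A u v ≡ true → adj H (σ ⟨$⟩ʳ u) (σ ⟨$⟩ʳ v) ≡ true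

  abstract
    embeds? : ∀ σ → Dec (Embeds σ)
    embeds? σ = Fin.all? λ u → Fin.all? λ v →
      (adj A u v Bool.≟ true) →-dec (adj H (σ ⟨$⟩ʳ u) (σ ⟨$⟩ʳ v) Bool.≟ true)

  embeddings : ℕ
  embeddings = sumOver (perms n) (λ σ → ⟦ embeds? σ ⟧)

module _ (A : Graph n) where

  Automorphism : Permutation′ n → Set
  Automorphism σ = ∀ u v → adj A (σ ⟨$⟩ʳ u) (σ ⟨$⟩ʳ v) ≡ adj A u v

  abstract
    automorphism? : ∀ σ → Dec (Automorphism σ)
    automorphism? σ = Fin.all? λ u → Fin.all? λ v →
      adj A (σ ⟨$⟩ʳ u) (σ ⟨$⟩ʳ v) Bool.≟ adj A u v

  automorphisms : ℕ
  automorphisms = sumOver (perms n) (λ σ → ⟦ automorphism? σ ⟧)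

  automorphisms>0 : 0 < automorphisms
  automorphisms>0 =
    let ρ , ρ∈ , ρ≈id = perms-complete Perm.id in
    ≤-trans (≤-reflexive (sym (⟦⟧-true (automorphism? ρ)
              λ u v → cong₂ (adj A) (ρ≈id u) (ρ≈id v))))
            (∈⇒≤sumOver (λ σ → ⟦ automorphism? σ ⟧) ρ∈)

module _ {m} (G : Graph m) where

  -- The term of M_G at `r` and `π` describes a copy of `G` in which the label `r ‼ k` plays the
  -- vertex `π ⟨$⟩ʳ k`; these are the edges of that copy, in both orientations.
  record CopyEdge (r : Increasing 0 m) (π : Permutation′ m) (x y : ℕ) : Set where
    constructor copyEdge
    field
      k l  : Fin m
      r‼k≡ : r ‼ k ≡ x
      r‼l≡ : r ‼ l ≡ y
      edge : adj G (π ⟨$⟩ʳ k) (π ⟨$⟩ʳ l) ≡ true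

  copyEdge? : ∀ r π x y → Dec (CopyEdge r π x y)
  copyEdge? r π x y = map′ (λ (k , l , k≡ , l≡ , kl) → copyEdge k l k≡ l≡ kl)
    (λ (copyEdge k l k≡ l≡ kl) → k , l , k≡ , l≡ , kl) (Fin.any? λ k → Fin.any? λ l →
    (r ‼ k ≟ x) ×-dec (r ‼ l ≟ y) ×-dec (adj G (π ⟨$⟩ʳ k) (π ⟨$⟩ʳ l) Bool.≟ true))

  CopyIn : Graph n → Increasing 0 m → Permutation′ m → Set
  CopyIn H r π = ∀ u v → CopyEdge r π (label u) (label v) → adj H u v ≡ true

  abstract
    copyIn? : ∀ (H : Graph n) r π → Dec (CopyIn H r π)
    copyIn? H r π = Fin.all? λ u → Fin.all? λ v →
      copyEdge? r π (label u) (label v) →-dec (adj H u v Bool.≟ true)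

module _ {m n : ℕ} {G : Graph m} (R : Representatives G) where
  open Representatives R

  indices : List (Increasing 0 m × Fin size)
  indices = cartesianProduct (bounded n 0 m) (allFin size)

  copies : Graph n → ℕ
  copies H = sumOver indices (λ (r , s) → ⟦ copyIn? G H r (perm s) ⟧)

  -- Here `A` is `G` placed on the vertices `e i`, and every other vertex of `A` is isolated.
  module _ (neighbour : ∀ i → ∃[ j ] adj G i j ≡ true)
           {A : Graph n} {e : Fin m → Fin n} (e-injective : Injective e)
           (e-adj : ∀ i j → adj A (e i) (e j) ≡ adj G i j)
           (e-support : ∀ {u v} → adj A u v ≡ true → ∃[ i ] e i ≡ u) where

    -- The image of A under σ is the copy of G indexed by i.
    record Copy (σ : Permutation′ n) (i : Increasing 0 m × Fin size) : Set where
      constructor copy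
      field
        bound : Bounded n (proj₁ i)
        to    : ∀ u v → adj A u v ≡ true →
                CopyEdge G (proj₁ i) (perm (proj₂ i)) (label (σ ⟨$⟩ʳ u)) (label (σ ⟨$⟩ʳ v))
        from  : ∀ u v →
                CopyEdge G (proj₁ i) (perm (proj₂ i)) (label (σ ⟨$⟩ʳ u)) (label (σ ⟨$⟩ʳ v)) →
                adj A u v ≡ true

    abstract
      copy? : ∀ σ i → Dec (Copy σ i)
      copy? σ (r , s) =
        let E? = λ u v → copyEdge? G r (perm s) (label (σ ⟨$⟩ʳ u)) (label (σ ⟨$⟩ʳ v))
            A? = λ u v → adj A u v Bool.≟ true
        in map′ (λ (b , t , f) → copy b t f) (λ (copy b t f) → b , t , f)
        (Fin.all? (λ k → r ‼ k ≤? n)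
          ×-dec Fin.all? (λ u → Fin.all? λ v → A? u v →-dec E? u v)
          ×-dec Fin.all? (λ u → Fin.all? λ v → E? u v →-dec A? u v))

    private
      preimage : ∀ (σ : Permutation′ n) (r : Increasing 0 m) → Bounded n r → ∀ k →
                 ∃[ u ] label (σ ⟨$⟩ʳ u) ≡ r ‼ k
      preimage σ r r≤n k =
        let u , u≡ = label-surjective (‼-lower r k) (r≤n k)
        in σ ⟨$⟩ˡ u , trans (cong label (inverseʳ σ)) u≡

      transfer : ∀ {σ i j} → Copy σ i → Copy σ j → ∀ {x y} →
                 CopyEdge G (proj₁ i) (perm (proj₂ i)) x y →
                 CopyEdge G (proj₁ j) (perm (proj₂ j)) x y
      transfer {σ} {r , _} c c′ (copyEdge k l refl refl kl) =
        let u , u≡ = preimage σ r (Copy.bound c) k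
            v , v≡ = preimage σ r (Copy.bound c) l
        in subst₂ (CopyEdge G _ _) u≡ v≡
             (Copy.to c′ u v (Copy.from c u v (copyEdge k l (sym u≡) (sym v≡) kl)))

      -- As `G` has no isolated vertex, each label of a copy lies on one of its edges, so the edges
      -- determine the set of labels.
      image⊆ : ∀ {σ i j} → Copy σ i → Copy σ j → ∀ k → ∃[ l ] proj₁ i ‼ k ≡ proj₁ j ‼ l
      image⊆ {i = _ , s} c c′ k =
        let w , kw = neighbour (perm s ⟨$⟩ʳ k)
            copyEdge k′ _ eq _ _ = transfer c c′ (copyEdge k (perm s ⟨$⟩ˡ w) refl refl
              (trans (cong (adj G (perm s ⟨$⟩ʳ k)) (inverseʳ (perm s))) kw))
        in k′ , sym eq

      adj⊆ : ∀ {σ r s s′} → Copy σ (r , s) → Copy σ (r , s′) → ∀ k l →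
             adj G (perm s ⟨$⟩ʳ k) (perm s ⟨$⟩ʳ l) ≡ true →
             adj G (perm s′ ⟨$⟩ʳ k) (perm s′ ⟨$⟩ʳ l) ≡ true
      adj⊆ {r = r} {s′ = s′} c c′ k l kl with transfer c c′ (copyEdge k l refl refl kl)
      ... | copyEdge k′ l′ k≡ l≡ kl′ =
        subst₂ (λ k l → adj G (perm s′ ⟨$⟩ʳ k) (perm s′ ⟨$⟩ʳ l) ≡ true) (‼-injective r k≡) (‼-injective r l≡) kl′

    -- The image of `A` under `σ` fixes the edges, hence the labels and thus `r`. With `r` fixed,
    -- the edges determine the family, and distinct representatives have distinct families.
    copy-unique : ∀ {σ i j} → Copy σ i → Copy σ j → i ≡ j
    copy-unique {i = r , s} {r′ , s′} c c′ with sameImage⇒≡ {r = r} {r′} (image⊆ c c′ , image⊆ c′ c)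
    ... | refl = cong (r ,_) (distinct s s′ λ p →
      trans (a-· G (perm s) p) (trans
        (cong bit (true-ext (adj⊆ c c′ _ _) (adj⊆ c′ c _ _)))
        (sym (a-· G (perm s′) p))))

    -- If `r` lists the labels of the placed vertices in the order given by `π`, the edges are right
    -- for `π` itself; exchanging `π` for a representative of the same family leaves them unchanged.
    copy-intro : ∀ σ r s π → (∀ k → r ‼ k ≡ label (σ ⟨$⟩ʳ e (π ⟨$⟩ʳ k))) →
                 SameFamily G π (perm s) → Copy σ (r , s)
    copy-intro σ r s π r≡ same = copy r≤n to from
      where
      r≤n : Bounded n r
      r≤n k = subst (_≤ n) (sym (r≡ k)) (Fin.toℕ<n _)

      at : ∀ i → r ‼ (π ⟨$⟩ˡ i) ≡ label (σ ⟨$⟩ʳ e i)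
      at i = trans (r≡ _) (cong (λ j → label (σ ⟨$⟩ʳ e j)) (inverseʳ π))

      to : ∀ u v → adj A u v ≡ true → CopyEdge G r (perm s) (label (σ ⟨$⟩ʳ u)) (label (σ ⟨$⟩ʳ v))
      to u v uv with e-support uv | e-support (trans (adj-sym A v u) uv)
      ... | i , refl | j , refl = copyEdge (π ⟨$⟩ˡ i) (π ⟨$⟩ˡ j) (at i) (at j) (begin
        adj G (perm s ⟨$⟩ʳ (π ⟨$⟩ˡ i)) (perm s ⟨$⟩ʳ (π ⟨$⟩ˡ j)) ≡⟨ sameFamily⇒adj G {π} {perm s} same _ _ ⟨
        adj G (π ⟨$⟩ʳ (π ⟨$⟩ˡ i)) (π ⟨$⟩ʳ (π ⟨$⟩ˡ j))           ≡⟨ cong₂ (adj G) (inverseʳ π) (inverseʳ π) ⟩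
        adj G i j                                               ≡⟨ e-adj i j ⟨
        adj A (e i) (e j)                                       ≡⟨ uv ⟩
        true                                                    ∎)
        where open ≡-Reasoning

      back : ∀ {k u} → r ‼ k ≡ label (σ ⟨$⟩ʳ u) → e (π ⟨$⟩ʳ k) ≡ u
      back {k} eq = ⟨$⟩ʳ-injective σ (label-injective (trans (sym (r≡ k)) eq))

      from : ∀ u v → CopyEdge G r (perm s) (label (σ ⟨$⟩ʳ u)) (label (σ ⟨$⟩ʳ v)) → adj A u v ≡ true
      from u v (copyEdge k l k≡ l≡ kl) = begin
        adj A u v                                   ≡⟨ cong₂ (adj A) (back k≡) (back l≡) ⟨
        adj A (e (π ⟨$⟩ʳ k)) (e (π ⟨$⟩ʳ l))         ≡⟨ e-adj _ _ ⟩
        adj G (π ⟨$⟩ʳ k) (π ⟨$⟩ʳ l)                 ≡⟨ sameFamily⇒adj G {π} {perm s} same k l ⟩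
        adj G (perm s ⟨$⟩ʳ k) (perm s ⟨$⟩ʳ l)       ≡⟨ kl ⟩
        true                                        ∎
        where open ≡-Reasoning

    copy-exists : ∀ σ → ∃[ i ] i ∈ indices × Copy σ i
    copy-exists σ =
      let r , π , r≡ = sort 0 (λ i → label (σ ⟨$⟩ʳ e i))
                         (e-injective ∘ ⟨$⟩ʳ-injective σ ∘ label-injective) (λ _ → z<s)
          s , same   = exhaust π
          c          = copy-intro σ r s π r≡ same
      in (r , s) , ∈-cartesianProduct⁺ (bounded-complete n r (Copy.bound c)) (∈-allFin s) , c

    copy-reached : ∀ {i} → i ∈ indices → ∃[ τ ] Copy τ i
    copy-reached {r , s} i∈ =
      let r∈ , _ = ∈-cartesianProduct⁻ (bounded n 0 m) (allFin size) i∈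
          vertex = λ k → label-surjective (‼-lower r k) (bounded-sound r r∈ k)
          π = perm s
          -- The vertex `e i` must go to the vertex whose label plays `i` in the copy. This
          -- prescribes `τ` on the image of `e` only; the isolated vertices of `A` are placed
          -- arbitrarily.
          τ , τe = extend e (λ i → proj₁ (vertex (π ⟨$⟩ˡ i))) e-injective λ {i} {j} eq →
            ⟨$⟩ʳ-injective (flip π) (‼-injective r (trans (sym (proj₂ (vertex _)))
              (trans (cong label eq) (proj₂ (vertex _)))))
      in τ , copy-intro τ r s π
           (λ k → sym (trans (cong label (τe _))
                    (trans (proj₂ (vertex _)) (cong (r ‼_) (inverseˡ π)))))
           (λ _ → refl)

    -- Fix one `τ` that maps `A` onto the copy. The others are exactly the permutations obtained by
    -- applying an automorphism of `A` first and `τ` afterwards, a coset of the automorphism group.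
    copy-fibre : ∀ {i} → i ∈ indices →
                 sumOver (perms n) (λ σ → ⟦ copy? σ i ⟧) ≡ automorphisms A
    copy-fibre {i} i∈ with τ , c ← copy-reached i∈ = sumOver-translate τ λ {ρ} {σ} ρ≈ →
      let forth = λ u v → subst₂ (λ x y → E (label x) (label y)) (ρ≈ u) (ρ≈ v)
          back  = λ u v → subst₂ (λ x y → E (label x) (label y)) (sym (ρ≈ u)) (sym (ρ≈ v))
      in ⟦⟧-cong (copy? ρ i) (automorphism? A σ)
        (λ d u v → true-ext (λ uv → Copy.from d u v (back u v (Copy.to c _ _ uv)))
                            (λ uv → Copy.from c _ _ (forth u v (Copy.to d u v uv))))
        (λ aut → copy (Copy.bound c)
          (λ u v uv → back u v (Copy.to c _ _ (trans (aut u v) uv)))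
          (λ u v uv → trans (sym (aut u v)) (Copy.from c _ _ (forth u v uv))))
      where
      E : ℕ → ℕ → Set
      E = CopyEdge G (proj₁ i) (perm (proj₂ i))

    copy⇒embeds≡copyIn : ∀ (H : Graph n) {σ i} → Copy σ i →
                         ⟦ embeds? A H σ ⟧ ≡ ⟦ copyIn? G H (proj₁ i) (perm (proj₂ i)) ⟧
    copy⇒embeds≡copyIn H {σ} {i} c = ⟦⟧-cong (embeds? A H σ) (copyIn? G H _ _)
      (λ emb u v uv → subst₂ (λ u v → adj H u v ≡ true) (inverseʳ σ) (inverseʳ σ)
        (emb _ _ (Copy.from c _ _
          (subst₂ (λ u v → CopyEdge G (proj₁ i) (perm (proj₂ i)) (label u) (label v))
            (sym (inverseʳ σ)) (sym (inverseʳ σ)) uv))))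
      (λ copyIn u v uv → copyIn _ _ (Copy.to c u v uv))

    embeddings≡ : ∀ H → embeddings A H ≡ automorphisms A * copies H
    embeddings≡ H = sumOver-fibres copy? (perms n) indices (copy⇒embeds≡copyIn H)
      (λ {σ} _ → let i , i∈ , c = copy-exists σ in
        sumOver-≡1 (copy? σ)
          (Unique.cartesianProduct⁺ (bounded-unique n 0 m) (Unique.allFin⁺ size)) i∈ c copy-unique)
      (automorphisms A) copy-fibre

-- Graphs given by relations, and edge numbers under injections

does⇒ : ∀ {P : Set} (P? : Dec P) → does P? ≡ true → P
does⇒ (yes p) _ = p

module _ {n} (E : Fin n → Fin n → Set) (E? : ∀ u v → Dec (E u v))
         (E-sym : ∀ {u v} → E u v → E v u) (E-irrefl : ∀ {u} → ¬ E u u) where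

  relationGraph : Graph n
  relationGraph = record
    { adj        = λ u v → does (E? u v)
    ; adj-sym    = λ u v → true-ext (λ uv → dec-true (E? v u) (E-sym (does⇒ (E? u v) uv)))
                                    (λ vu → dec-true (E? u v) (E-sym (does⇒ (E? v u) vu)))
    ; adj-irrefl = λ u → dec-false (E? u u) E-irrefl
    }

endpoints? : ∀ (p : Pair n) i j → Dec (Endpoints p i j)
endpoints? p i j = ((Pair.fst p Fin.≟ i) ×-dec (Pair.snd p Fin.≟ j))
            ⊎-dec ((Pair.fst p Fin.≟ j) ×-dec (Pair.snd p Fin.≟ i))

endpoints-sym : ∀ {p : Pair n} {i j} → Endpoints p i j → Endpoints p j i
endpoints-sym (inj₁ e) = inj₂ e
endpoints-sym (inj₂ e) = inj₁ e

endpoints-irrefl : ∀ {p : Pair n} {i} → ¬ Endpoints p i i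
endpoints-irrefl {p = p} (inj₁ (refl , s)) = Fin.<⇒≢ (Pair.fst<snd p) (sym s)
endpoints-irrefl {p = p} (inj₂ (refl , s)) = Fin.<⇒≢ (Pair.fst<snd p) (sym s)

endpoints-exist : ∀ {i j : Fin n} → i ≢ j → ∃[ p ] Endpoints p i j
endpoints-exist {i = i} {j} i≢j with Fin.<-cmp i j
... | tri< i<j _ _ = pair i j i<j , inj₁ (refl , refl)
... | tri≈ _ i≡j _ = contradiction i≡j i≢j
... | tri> _ _ j<i = pair j i j<i , inj₂ (refl , refl)

endpoints-cases : ∀ (p : Pair n) {i j k l} → Endpoints p i j → Endpoints p k l →
                  (i ≡ k × j ≡ l) ⊎ (i ≡ l × j ≡ k)
endpoints-cases p (inj₁ (refl , refl)) (inj₁ e)       = inj₁ e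
endpoints-cases p (inj₁ (refl , refl)) (inj₂ e)       = inj₂ e
endpoints-cases p (inj₂ (refl , refl)) (inj₁ (f , s)) = inj₂ (s , f)
endpoints-cases p (inj₂ (refl , refl)) (inj₂ (f , s)) = inj₁ (s , f)

module _ {m n} {G : Graph m} {A : Graph n} {e : Fin m → Fin n} (e-injective : Injective e)
         (e-adj : ∀ i j → adj A (e i) (e j) ≡ adj G i j) where

  edges-mono : edges G ≤ edges A
  edges-mono = sumOver-injection (λ p q → endpoints? q (e (Pair.fst p)) (e (Pair.snd p)))
    (pairs m) (pairs n) {a G} {a A}
    (λ {p} {q} q-ends → cong bit (sym (trans (adjₚ-endpoints A {q} q-ends) (e-adj _ _))))
    (λ {p} _ →
      let q , q-ends = endpoints-exist (Fin.<⇒≢ (Pair.fst<snd p) ∘ e-injective)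
      in sumOver-≡1 (λ q → endpoints? q (e (Pair.fst p)) (e (Pair.snd p))) (pairs-unique n)
           (pair∈pairs q) q-ends (λ {q} {q′} → endpoints-unique {p = q} {q′}))
    (λ q → sumOver-≤1 (λ p → endpoints? q (e (Pair.fst p)) (e (Pair.snd p))) (pairs-unique m)
      (λ {p} {p′} ends ends′ → endpoints-unique {p = p} {p′} (inj₁ (refl , refl))
        (swapped (endpoints-cases q ends′ ends))))
    where
    -- Two pairs of `G` with the same image in `A` have the same endpoints up to order, because `e`
    -- is injective.
    swapped : ∀ {i j k l} → (e k ≡ e i × e l ≡ e j) ⊎ (e k ≡ e j × e l ≡ e i) →
              (k ≡ i × l ≡ j) ⊎ (k ≡ j × l ≡ i)
    swapped (inj₁ (f , s)) = inj₁ (e-injective f , e-injective s)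
    swapped (inj₂ (f , s)) = inj₂ (e-injective f , e-injective s)

-- From copies to embeddings

SameCopies : ℕ → Graph n → Graph n → Set
SameCopies {n} k H₁ H₂ = ∀ {m} (G : Graph (2 + m)) → NoIsolatedVertex G → 2 + m ≤ n → edges G ≤ k →
  copies (representatives G) H₁ ≡ copies (representatives G) H₂

SameEmbeddings : ℕ → Graph n → Graph n → Set
SameEmbeddings k H₁ H₂ = ∀ A → edges A ≤ k → embeddings A H₁ ≡ embeddings A H₂

module _ (A : Graph n) where

  hasNeighbour? : ∀ u → Dec (∃[ v ] adj A u v ≡ true)
  hasNeighbour? u = Fin.any? (λ v → adj A u v Bool.≟ true)

  support : List (Fin n)
  support = filter hasNeighbour? (allFin n)

  private
    e : Fin (length support) → Fin n
    e = lookup support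

    G : Graph (length support)
    G = record
      { adj        = λ i j → adj A (e i) (e j)
      ; adj-sym    = λ i j → adj-sym A (e i) (e j)
      ; adj-irrefl = λ i → adj-irrefl A (e i)
      }

    e-injective : Injective e
    e-injective = lookup-injective sym (Unique.filter⁺ hasNeighbour? (Unique.allFin⁺ n))

    e-support : ∀ {u v} → adj A u v ≡ true → ∃[ i ] e i ≡ u
    e-support uv = let u∈ = ∈-filter⁺ hasNeighbour? (∈-allFin _) (_ , uv)
                   in Any.index u∈ , sym (Any.lookup-index u∈)

    neighbour : ∀ i → ∃[ j ] adj G i j ≡ true
    neighbour i =
      let _ , v , iv = ∈-filter⁻ hasNeighbour? {xs = allFin n} (∈-lookup i)
          j , ej≡v = e-support (trans (adj-sym A v (e i)) iv)
      in j , trans (cong (adj A (e i)) ej≡v) iv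

    small : length support ≤ n
    small = ≤-trans (length-filter hasNeighbour? (allFin n))
      (≤-reflexive (length-tabulate {n = n} (λ i → i)))

  private
    -- The number of vertices is generalised from `length support` to a variable `m`, so that it can
    -- be matched against the cases of `NoIsolatedVertex`.
    by-size : ∀ {k H₁ H₂} → SameCopies k H₁ H₂ → edges A ≤ k →
              ∀ {m} (G : Graph m) (e : Fin m → Fin n) → Injective e →
              (∀ i j → adj A (e i) (e j) ≡ adj G i j) →
              (∀ {u v} → adj A u v ≡ true → ∃[ i ] e i ≡ u) →
              (∀ i → ∃[ j ] adj G i j ≡ true) → m ≤ n →
              embeddings A H₁ ≡ embeddings A H₂
    -- Without vertices in the support `A` has no edges, and every permutation embeds it vacuously.
    by-size {H₁ = H₁} {H₂} same _ {zero} G e _ _ e-support _ _ =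
      sumOver-cong (perms n) λ {σ} _ → ⟦⟧-cong (embeds? A H₁ σ) (embeds? A H₂ σ)
        (λ _ u v uv → contradiction (proj₁ (e-support uv)) λ ())
        (λ _ u v uv → contradiction (proj₁ (e-support uv)) λ ())
    -- A support of size one cannot occur: its only vertex would be its own neighbour.
    by-size _ _ {suc zero} G e _ _ _ neighbour _ with neighbour zero
    ... | zero , loop = contradiction (trans (sym (adj-irrefl G zero)) loop) λ ()
    by-size {H₁ = H₁} {H₂} same A≤k {suc (suc m)} G e e-inj e-adj e-support neighbour m≤n = begin
      embeddings A H₁
        ≡⟨ embeddings≡ R neighbour e-inj e-adj e-support H₁ ⟩
      automorphisms A * copies R H₁
        ≡⟨ cong (automorphisms A *_)
             (same G neighbour m≤n (≤-trans (edges-mono {G = G} {A} e-inj e-adj) A≤k)) ⟩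
      automorphisms A * copies R H₂
        ≡⟨ embeddings≡ R neighbour e-inj e-adj e-support H₂ ⟨
      embeddings A H₂ ∎
      where
      open ≡-Reasoning
      R = representatives G

  sameCopies⇒≡embeddings : ∀ {k H₁ H₂} → SameCopies k H₁ H₂ → edges A ≤ k →
                            embeddings A H₁ ≡ embeddings A H₂
  sameCopies⇒≡embeddings {k} {H₁} {H₂} same A≤k =
    by-size {k} {H₁} {H₂} same A≤k G e e-injective (λ _ _ → refl) e-support neighbour small

-- Adding isolated vertices, and invariance under isomorphism

module _ {m n} (G : Graph m) (e : Fin m → Fin n) (e-injective : Injective e) where

  private
    E : Fin n → Fin n → Set
    E u v = ∃[ i ] ∃[ j ] e i ≡ u × e j ≡ v × adj G i j ≡ true

    E? : ∀ u v → Dec (E u v)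
    E? u v = Fin.any? λ i → Fin.any? λ j →
      (e i Fin.≟ u) ×-dec (e j Fin.≟ v) ×-dec (adj G i j Bool.≟ true)

    E-irrefl : ∀ {u} → ¬ E u u
    E-irrefl (i , j , refl , ej≡ei , ij) with e-injective ej≡ei
    ... | refl = contradiction (trans (sym (adj-irrefl G i)) ij) λ ()

  pushforward : Graph n
  pushforward = relationGraph E E?
    (λ (i , j , i≡ , j≡ , ij) → j , i , j≡ , i≡ , trans (adj-sym G j i) ij) E-irrefl

  pushforward-adj : ∀ i j → adj pushforward (e i) (e j) ≡ adj G i j
  pushforward-adj i j = true-ext
    (λ ij → edge (does⇒ (E? (e i) (e j)) ij))
    (λ ij → dec-true (E? (e i) (e j)) (i , j , refl , refl , ij))
    where
    edge : E (e i) (e j) → adj G i j ≡ true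
    edge (k , l , k≡ , l≡ , kl) =
      subst₂ (λ i j → adj G i j ≡ true) (e-injective k≡) (e-injective l≡) kl

  pushforward-support : ∀ {u v} → adj pushforward u v ≡ true → ∃[ i ] e i ≡ u
  pushforward-support {u} {v} uv = let i , _ , i≡ , _ = does⇒ (E? u v) uv in i , i≡

embeddings-≅ : ∀ (A : Graph n) {H₁ H₂} → H₁ ≅ H₂ → embeddings A H₁ ≡ embeddings A H₂
embeddings-≅ A {H₁} {H₂} (π , iso) = sym (sumOver-translate π λ {ρ} {σ} ρ≈ →
  let H₁≡H₂ = λ u v → trans (iso (σ ⟨$⟩ʳ u) (σ ⟨$⟩ʳ v)) (sym (cong₂ (adj H₂) (ρ≈ u) (ρ≈ v)))
  in ⟦⟧-cong (embeds? A H₂ ρ) (embeds? A H₁ σ)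
    (λ emb u v uv → trans (H₁≡H₂ u v) (emb u v uv))
    (λ emb u v uv → trans (sym (H₁≡H₂ u v)) (emb u v uv)))

copies-≅ : ∀ {G : Graph (2 + m)} (R : Representatives G) → NoIsolatedVertex G → 2 + m ≤ n →
           {H₁ H₂ : Graph n} → H₁ ≅ H₂ → copies R H₁ ≡ copies R H₂
copies-≅ {m} {n} {G} R G° m≤n {H₁} {H₂} iso =
  *-cancelˡ-≡ _ _ (automorphisms padded) {{>-nonZero (automorphisms>0 padded)}}
    (trans (sym (factor H₁)) (trans (embeddings-≅ padded iso) (factor H₂)))
  where
  e : Fin (2 + m) → Fin n
  e i = Fin.inject≤ i m≤n

  e-injective : Injective e
  e-injective = Fin.inject≤-injective m≤n m≤n _ _

  padded : Graph n
  padded = pushforward G e e-injective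

  factor : ∀ H → embeddings padded H ≡ automorphisms padded * copies R H
  factor = embeddings≡ R G° {padded} {e} e-injective
    (pushforward-adj G e e-injective) (pushforward-support G e e-injective)

length≡sumOver : ∀ {A : Set} (xs : List A) → length xs ≡ sumOver xs (λ _ → 1)
length≡sumOver []       = refl
length≡sumOver (_ ∷ xs) = cong suc (length≡sumOver xs)

length-filter≡sumOver : ∀ {A : Set} {P : A → Set} (P? : ∀ x → Dec (P x)) xs →
                        length (filter P? xs) ≡ sumOver xs (λ x → ⟦ P? x ⟧)
length-filter≡sumOver P? []       = refl
length-filter≡sumOver P? (x ∷ xs) with P? x
... | yes _ = cong suc (length-filter≡sumOver P? xs)
... | no  _ = length-filter≡sumOver P? xs

-- Inclusion–exclusion

module _ (ps : List (Pair n)) where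

  private
    E? : ∀ u v → Dec (Any.Any (λ p → Endpoints p u v) ps)
    E? u v = Any.any? (λ p → endpoints? p u v) ps

  pairGraph : Graph n
  pairGraph = relationGraph (λ u v → Any.Any (λ p → Endpoints p u v) ps) E?
    (Any.map (λ {p} → endpoints-sym {p = p}))
    (λ loop → let p , _ , pp = find loop in endpoints-irrefl {p = p} pp)

  -- Only an inequality, since `ps` may contain repetitions: every edge is covered by some entry,
  -- and every entry covers at most one edge.
  edges-pairGraph : edges pairGraph ≤ length ps
  edges-pairGraph = begin
    sumOver (pairs n) (a pairGraph)
      ≤⟨ sumOver-mono (pairs n) covered ⟩
    sumOver (pairs n) (λ p → sumOver ps (λ q → ⟦ endpoints? q (Pair.fst p) (Pair.snd p) ⟧))
      ≡⟨ sumOver-swap (pairs n) ps _ ⟩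
    sumOver ps (λ q → sumOver (pairs n) (λ p → ⟦ endpoints? q (Pair.fst p) (Pair.snd p) ⟧))
      ≤⟨ sumOver-mono ps (λ q →
           sumOver-≤1 (λ p → endpoints? q (Pair.fst p) (Pair.snd p)) (pairs-unique n) (λ {p} {p′} ends ends′ → endpoints-unique {p = p} {p′} (inj₁ (refl , refl))
             (endpoints-cases q ends′ ends))) ⟩
    sumOver ps (λ _ → 1)
      ≡⟨ length≡sumOver ps ⟨
    length ps ∎
    where
    open ≤-Reasoning
    covered : ∀ p → a pairGraph p ≤ sumOver ps (λ q → ⟦ endpoints? q (Pair.fst p) (Pair.snd p) ⟧)
    covered p@(pair i j _) with E? i j
    ... | no  _   = z≤n
    ... | yes any = let q , q∈ , ends = find any in
      ≤-trans (≤-reflexive (sym (⟦⟧-true (endpoints? q i j) ends)))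
              (∈⇒≤sumOver (λ q → ⟦ endpoints? q i j ⟧) q∈)

  embeds-pairGraph⇒ : ∀ {H σ} → Embeds pairGraph H σ → All (λ p → adjₚ H (σ · p) ≡ true) ps
  embeds-pairGraph⇒ {H} {σ} emb = All.tabulate λ {p} p∈ → trans (adjₚ-· H σ p)
    (emb _ _ (dec-true (E? (Pair.fst p) (Pair.snd p)) (lose p∈ (inj₁ (refl , refl)))))

  embeds-pairGraph⇐ : ∀ {H σ} → All (λ p → adjₚ H (σ · p) ≡ true) ps → Embeds pairGraph H σ
  embeds-pairGraph⇐ {H} {σ} all u v uv =
    let p , p∈ , ends = find (does⇒ (E? u v) uv)
    in trans (sym (adjₚ-endpoints H {σ · p} (endpoints-map {p = p} σ ends))) (All.lookup all p∈)

module _ (H : Graph n) where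

  Separates : (A B : List (Pair n)) → Permutation′ n → Set
  Separates A B σ = All (λ p → adjₚ H (σ · p) ≡ true) A × All (λ p → adjₚ H (σ · p) ≡ false) B

  abstract
    separates? : ∀ A B σ → Dec (Separates A B σ)
    separates? A B σ = All.all? (λ p → adjₚ H (σ · p) Bool.≟ true) A
                 ×-dec All.all? (λ p → adjₚ H (σ · p) Bool.≟ false) B

  separators : (A B : List (Pair n)) → ℕ
  separators A B = sumOver (perms n) (λ σ → ⟦ separates? A B σ ⟧)

  separators-[] : ∀ A → separators A [] ≡ embeddings (pairGraph A) H
  separators-[] A = sumOver-cong (perms n) λ {σ} _ →
    ⟦⟧-cong (separates? A [] σ) (embeds? (pairGraph A) H σ)
      (λ (all , _) → embeds-pairGraph⇐ A {H} {σ} all) (λ emb → embeds-pairGraph⇒ A {H} {σ} emb , [])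

  -- One step of inclusion-exclusion: the permutations separating `A` from `B` split according to
  -- whether they send `q` to an edge or to a non-edge.
  separators-∷ : ∀ A q B → separators A (q ∷ B) + separators (q ∷ A) B ≡ separators A B
  separators-∷ A q B = trans (sym (sumOver-+ (perms n) _ _))
    (sumOver-cong (perms n) λ {σ} _ → split σ)
    where
    split : ∀ σ → ⟦ separates? A (q ∷ B) σ ⟧ + ⟦ separates? (q ∷ A) B σ ⟧ ≡ ⟦ separates? A B σ ⟧
    split σ with adjₚ H (σ · q) in eq
    ... | true  = cong₂ _+_
      (⟦⟧-false (separates? A (q ∷ B) σ) λ { (_ , ¬q ∷ _) → contradiction (trans (sym ¬q) eq) λ () })
      (⟦⟧-cong (separates? (q ∷ A) B σ) (separates? A B σ)
        (λ { (_ ∷ as , bs) → as , bs }) (λ (as , bs) → eq ∷ as , bs))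
    ... | false = trans (cong₂ _+_
      (⟦⟧-cong (separates? A (q ∷ B) σ) (separates? A B σ)
        (λ { (as , _ ∷ bs) → as , bs }) (λ (as , bs) → as , eq ∷ bs))
      (⟦⟧-false (separates? (q ∷ A) B σ) λ { (q ∷ _ , _) → contradiction (trans (sym q) eq) λ () }))
      (+-identityʳ _)

  -- For a fixed permutation, the pairs sent to edges are as many as the edges, since the
  -- permutation acts bijectively on pairs. Exchanging the sums gives this number once per
  -- permutation.
  separators-pairs : sumOver (pairs n) (λ q → separators [ q ] []) ≡ edges H * length (perms n)
  separators-pairs = begin
    sumOver (pairs n) (λ q → separators [ q ] [])
      ≡⟨ sumOver-swap (pairs n) (perms n) _ ⟩
    sumOver (perms n) (λ σ → sumOver (pairs n) (λ q → ⟦ separates? [ q ] [] σ ⟧))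
      ≡⟨ sumOver-cong (perms n) (λ {σ} _ →
           trans (sumOver-cong (pairs n) (λ {q} _ → single σ q)) (sumOver-· σ (a H))) ⟩
    sumOver (perms n) (λ _ → edges H)
      ≡⟨ sumOver-cong (perms n) (λ _ → sym (*-identityʳ (edges H))) ⟩
    sumOver (perms n) (λ _ → edges H * 1)
      ≡⟨ sumOver-*ˡ (edges H) (perms n) (λ _ → 1) ⟩
    edges H * sumOver (perms n) (λ _ → 1)
      ≡⟨ cong (edges H *_) (length≡sumOver (perms n)) ⟨
    edges H * length (perms n) ∎
    where
    open ≡-Reasoning
    single : ∀ σ q → ⟦ separates? [ q ] [] σ ⟧ ≡ a H (σ · q)
    single σ q with adjₚ H (σ · q) in eq
    ... | true  = ⟦⟧-true (separates? [ q ] [] σ) (eq ∷ [] , [])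
    ... | false = ⟦⟧-false (separates? [ q ] [] σ)
      λ { (q ∷ _ , _) → contradiction (trans (sym q) eq) λ () }

  edgeList nonEdgeList : List (Pair n)
  edgeList    = filter (λ p → adjₚ H p Bool.≟ true) (pairs n)
  nonEdgeList = filter (λ p → adjₚ H p Bool.≟ false) (pairs n)

  length-edgeList : length edgeList ≡ edges H
  length-edgeList = trans (length-filter≡sumOver (λ p → adjₚ H p Bool.≟ true) (pairs n))
    (sumOver-cong (pairs n) λ {p} _ → bit-≟ (adjₚ H p))
    where
    bit-≟ : ∀ x → ⟦ x Bool.≟ true ⟧ ≡ bit x
    bit-≟ true  = refl
    bit-≟ false = refl

  edges+nonEdges : edges H + length nonEdgeList ≡ length (pairs n)
  edges+nonEdges = begin
    edges H + length nonEdgeList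
      ≡⟨ cong (edges H +_) (length-filter≡sumOver (λ p → adjₚ H p Bool.≟ false) (pairs n)) ⟩
    edges H + sumOver (pairs n) (λ p → ⟦ adjₚ H p Bool.≟ false ⟧)
      ≡⟨ sumOver-+ (pairs n) (a H) _ ⟨
    sumOver (pairs n) (λ p → a H p + ⟦ adjₚ H p Bool.≟ false ⟧)
      ≡⟨ sumOver-cong (pairs n) (λ {p} _ → bit+≟ (adjₚ H p)) ⟩
    sumOver (pairs n) (λ _ → 1)
      ≡⟨ length≡sumOver (pairs n) ⟨
    length (pairs n) ∎
    where
    open ≡-Reasoning
    bit+≟ : ∀ x → bit x + ⟦ x Bool.≟ false ⟧ ≡ 1
    bit+≟ true  = refl
    bit+≟ false = refl

-- The number of pairs

sumOver-cartesianProduct : ∀ {A B : Set} (xs : List A) (ys : List B) (f : A × B → ℕ) →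
  sumOver (cartesianProduct xs ys) f ≡ sumOver xs (λ x → sumOver ys (λ y → f (x , y)))
sumOver-cartesianProduct []       ys f = refl
sumOver-cartesianProduct (x ∷ xs) ys f = begin
  sum (map f (map (x ,_) ys ++ cartesianProduct xs ys))
    ≡⟨ cong sum (map-++ f (map (x ,_) ys) _) ⟩
  sum (map f (map (x ,_) ys) ++ map f (cartesianProduct xs ys))
    ≡⟨ sum-++ (map f (map (x ,_) ys)) _ ⟩
  sumOver (map (x ,_) ys) f + sumOver (cartesianProduct xs ys) f
    ≡⟨ cong₂ _+_ (sumOver-map ys (x ,_) f) (sumOver-cartesianProduct xs ys f) ⟩
  sumOver ys (λ y → f (x , y)) + sumOver xs (λ x → sumOver ys (λ y → f (x , y))) ∎
  where open ≡-Reasoning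

sumOver-allFin-suc : ∀ (f : Fin (suc n) → ℕ) →
                     sumOver (allFin (suc n)) f ≡ f zero + sumOver (allFin n) (f ∘ suc)
sumOver-allFin-suc {n} f = cong (f zero +_) (trans
  (cong (λ is → sumOver is f) (sym (map-tabulate (λ i → i) suc)))
  (sumOver-map (allFin n) suc f))

length-pairs : ∀ n → length (pairs n) ≡ n C 2
length-pairs n = begin
  length (pairs n)
    ≡⟨ length≡sumOver (pairs n) ⟩
  sumOver (pairs n) (λ _ → 1)
    ≡⟨ sumOver-concatMap (cartesianProduct (allFin n) (allFin n)) pairsFrom (λ _ → 1) ⟩
  sumOver (cartesianProduct (allFin n) (allFin n)) (λ ij → sumOver (pairsFrom ij) (λ _ → 1))
    ≡⟨ sumOver-cartesianProduct (allFin n) (allFin n) _ ⟩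
  sumOver (allFin n) (λ i → sumOver (allFin n) (λ j → sumOver (pairsFrom (i , j)) (λ _ → 1)))
    ≡⟨ sumOver-cong (allFin n) (λ {i} _ → sumOver-cong (allFin n) (λ {j} _ → pairsFrom≡ i j)) ⟩
  increasing n
    ≡⟨ increasing≡ n ⟩
  n C 2 ∎
  where
  open ≡-Reasoning
  pairsFrom≡ : ∀ {n} (i j : Fin n) → sumOver (pairsFrom (i , j)) (λ _ → 1) ≡ ⟦ i Fin.<? j ⟧
  pairsFrom≡ i j with i Fin.<? j
  ... | yes i<j = sym (⟦⟧-true (i Fin.<? j) i<j)
  ... | no  i≮j = sym (⟦⟧-false (i Fin.<? j) i≮j)

  increasing : ℕ → ℕ
  increasing n = sumOver (allFin n) (λ i → sumOver (allFin n) (λ j → ⟦ i Fin.<? j ⟧))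

  increasing≡ : ∀ n → increasing n ≡ n C 2
  increasing≡ zero    = refl
  increasing≡ (suc n) = begin
    increasing (suc n)
      ≡⟨ sumOver-allFin-suc {n} (λ i → sumOver (allFin (suc n)) (λ j → ⟦ i Fin.<? j ⟧)) ⟩
    sumOver (allFin (suc n)) (λ j → ⟦ zero {n} Fin.<? j ⟧)
      + sumOver (allFin n) (λ i → sumOver (allFin (suc n)) (λ j → ⟦ suc i Fin.<? j ⟧))
      ≡⟨ cong₂ _+_
           (trans (sumOver-allFin-suc {n} (λ j → ⟦ zero {n} Fin.<? j ⟧))
             (trans (sym (length≡sumOver (allFin n))) (length-tabulate {n = n} (λ i → i))))
           (sumOver-cong (allFin n) (λ {i} _ →
             trans (sumOver-allFin-suc {n} (λ j → ⟦ suc i Fin.<? j ⟧))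
               (sumOver-cong (allFin n) λ {j} _ →
                 ⟦⟧-cong (suc i Fin.<? suc j) (i Fin.<? j) s≤s⁻¹ s≤s))) ⟩
    -- The `n` pairs containing vertex `zero` and the pairs avoiding it give Pascal's recurrence.
    n + increasing n
      ≡⟨ cong₂ _+_ (sym (nC1≡n n)) (increasing≡ n) ⟩
    n C 1 + n C 2
      ≡⟨ nCk+nC[k+1]≡[n+1]C[k+1] n 1 ⟩
    suc n C 2 ∎

-- From equal counts to an isomorphism

isomorphism : ∀ {H₁ H₂ : Graph n} σ → (∀ p → a H₁ p ≡ a H₂ (σ · p)) → H₁ ≅ H₂
isomorphism {H₁ = H₁} {H₂} σ same = σ , iso
  where
  ordered : ∀ {i j} → i Fin.< j → adj H₁ i j ≡ adj H₂ (σ ⟨$⟩ʳ i) (σ ⟨$⟩ʳ j)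
  ordered i<j = bit-injective (trans (same (pair _ _ i<j)) (a-· H₂ σ (pair _ _ i<j)))

  iso : ∀ i j → adj H₁ i j ≡ adj H₂ (σ ⟨$⟩ʳ i) (σ ⟨$⟩ʳ j)
  iso i j with Fin.<-cmp i j
  ... | tri< i<j _ _  = ordered i<j
  ... | tri≈ _ refl _ = trans (adj-irrefl H₁ i) (sym (adj-irrefl H₂ _))
  ... | tri> _ _ j<i  = trans (adj-sym H₁ i j) (trans (ordered j<i) (adj-sym H₂ _ _))

perms-nonempty : ∀ n → NonZero (length (perms n))
perms-nonempty n with perms n | perms-complete {n} Perm.id
... | _ ∷ _ | _ = _

bit-mono : ∀ {x y} → (x ≡ true → y ≡ true) → bit x ≤ bit y
bit-mono {false}     _ = z≤n
bit-mono {true}  {y} f rewrite f refl = ≤-refl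

bit-mono-false : ∀ {x y} → (y ≡ false → x ≡ false) → bit x ≤ bit y
bit-mono-false {false}         _ = z≤n
bit-mono-false {true} {true}   _ = ≤-refl
bit-mono-false {true} {false}  f = contradiction (f refl) λ ()

module _ {k} {H₁ H₂ : Graph n} (same : SameEmbeddings k H₁ H₂) where

  -- Induction on `B`. Dropping `q` shortens the lists and moving it to `A` keeps their total
  -- length, so the graphs reached at `B = []` have at most `k` edges.
  separators≡ : ∀ B A → length A + length B ≤ k → separators H₁ A B ≡ separators H₂ A B
  separators≡ []      A A≤k = begin
    separators H₁ A []            ≡⟨ separators-[] H₁ A ⟩
    embeddings (pairGraph A) H₁   ≡⟨ same (pairGraph A) (≤-trans (edges-pairGraph A)
                                       (≤-trans (≤-reflexive (sym (+-identityʳ _))) A≤k)) ⟩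
    embeddings (pairGraph A) H₂   ≡⟨ separators-[] H₂ A ⟨
    separators H₂ A []            ∎
    where open ≡-Reasoning
  separators≡ (q ∷ B) A AqB≤k = +-cancelʳ-≡ (separators H₁ (q ∷ A) B) _ _ (begin
    separators H₁ A (q ∷ B) + separators H₁ (q ∷ A) B ≡⟨ separators-∷ H₁ A q B ⟩
    separators H₁ A B ≡⟨ separators≡ B A (≤-trans (+-monoʳ-≤ (length A) (n≤1+n _)) AqB≤k) ⟩
    separators H₂ A B ≡⟨ separators-∷ H₂ A q B ⟨
    separators H₂ A (q ∷ B) + separators H₂ (q ∷ A) B
      ≡⟨ cong (separators H₂ A (q ∷ B) +_)
           (separators≡ B (q ∷ A) (≤-trans (≤-reflexive (sym (+-suc _ _))) AqB≤k)) ⟨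
    separators H₂ A (q ∷ B) + separators H₁ (q ∷ A) B ∎)
    where open ≡-Reasoning

  edges≡ : 1 ≤ k → edges H₁ ≡ edges H₂
  edges≡ 1≤k = *-cancelʳ-≡ _ _ (length (perms n)) {{perms-nonempty n}} (begin
    edges H₁ * length (perms n)                      ≡⟨ separators-pairs H₁ ⟨
    sumOver (pairs n) (λ q → separators H₁ [ q ] [])
      ≡⟨ sumOver-cong (pairs n) (λ {q} _ → separators≡ [] [ q ] 1≤k) ⟩
    sumOver (pairs n) (λ q → separators H₂ [ q ] []) ≡⟨ separators-pairs H₂ ⟩
    edges H₂ * length (perms n)                      ∎)
    where open ≡-Reasoning

  transport : ∀ A B → Separates H₁ A B Perm.id → length A + length B ≤ k → ∃[ σ ] Separates H₂ A B σ
  transport A B sep AB≤k =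
    -- The list `perms n` is only known to contain the identity up to pointwise equality, so the
    -- separation in `H₁` is first carried over to the listed `ρ`.
    let ρ , ρ∈ , ρ≈id = perms-complete Perm.id
        σ , _ , 0< = sumOver-positive (perms n) (λ σ → ⟦ separates? H₂ A B σ ⟧) (begin-strict
          0                            <⟨ ≤-refl ⟩
          1                            ≡⟨ ⟦⟧-true (separates? H₁ A B ρ) (move ρ≈id sep) ⟨
          ⟦ separates? H₁ A B ρ ⟧      ≤⟨ ∈⇒≤sumOver (λ σ → ⟦ separates? H₁ A B σ ⟧) ρ∈ ⟩
          separators H₁ A B            ≡⟨ separators≡ B A AB≤k ⟩
          separators H₂ A B            ∎)
    in σ , ⟦⟧-positive (separates? H₂ A B σ) 0<
    where
    open ≤-Reasoning
    move : ∀ {ρ} → ρ Perm.≈ Perm.id → Separates H₁ A B Perm.id → Separates H₁ A B ρ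
    move {ρ} ρ≈id (as , bs) = All.map (λ {p} → trans (same-adj p)) as ,
                            All.map (λ {p} → trans (same-adj p)) bs
      where
      same-adj : ∀ p → adjₚ H₁ (ρ · p) ≡ adjₚ H₁ (Perm.id · p)
      same-adj p = bit-injective (≈⇒sameFamily H₁ {ρ} {Perm.id} ρ≈id p)

  sameEmbeddings⇒≅ : 1 ≤ k → length (pairs n) ≤ k + suc k → H₁ ≅ H₂
  sameEmbeddings⇒≅ 1≤k N≤2k+1 with edges H₁ ≤? k
  ... | yes e≤k =
    let σ , as , _ = transport (edgeList H₁) []
          (All.map (λ {p} → trans (adjₚ-· H₁ Perm.id p)) (All.all-filter _ (pairs n)) , [])
          (≤-trans (≤-reflexive (trans (+-identityʳ _) (length-edgeList H₁))) e≤k)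
    in isomorphism {H₁ = H₁} {H₂} σ λ p → sumOver-≡⇒≗ (pairs n) {a H₁} {λ p → a H₂ (σ · p)}
      (λ p → bit-mono λ p∈H₁ → All.lookup as (∈-filter⁺ _ (pair∈pairs p) p∈H₁))
      (≤-reflexive (trans (sumOver-· σ (a H₂)) (sym (edges≡ 1≤k))))
      (pair∈pairs p)
  ... | no  e≰k =
    let σ , _ , bs = transport [] (nonEdgeList H₁)
          ([] , All.map (λ {p} → trans (adjₚ-· H₁ Perm.id p)) (All.all-filter _ (pairs n)))
          -- There are at least k + 1 edges among at most 2k + 1 pairs, which leaves at most k
          -- non-edges.
          (+-cancelʳ-≤ (suc k) _ _ (begin
            length (nonEdgeList H₁) + suc k     ≤⟨ +-monoʳ-≤ (length (nonEdgeList H₁)) (≰⇒> e≰k) ⟩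
            length (nonEdgeList H₁) + edges H₁  ≡⟨ +-comm (length (nonEdgeList H₁)) (edges H₁) ⟩
            edges H₁ + length (nonEdgeList H₁)  ≡⟨ edges+nonEdges H₁ ⟩
            length (pairs n)                    ≤⟨ N≤2k+1 ⟩
            k + suc k                           ∎))
    -- Non-edges go to non-edges, so the inequality between the indicators points the other way from
    -- the first case.
    in isomorphism {H₁ = H₁} {H₂} σ λ p → sym (sumOver-≡⇒≗ (pairs n) {λ p → a H₂ (σ · p)} {a H₁}
      (λ p → bit-mono-false λ p∉H₁ → All.lookup bs (∈-filter⁺ _ (pair∈pairs p) p∉H₁))
      (≤-reflexive (trans (edges≡ 1≤k) (sym (sumOver-· σ (a H₂)))))
      (pair∈pairs p))
    where open ≤-Reasoning

n≤⌊n/2⌋+1+⌊n/2⌋ : ∀ n → n ≤ ⌊ n /2⌋ + suc ⌊ n /2⌋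
n≤⌊n/2⌋+1+⌊n/2⌋ n = ≤-trans (≤-reflexive (sym (⌊n/2⌋+⌈n/2⌉≡n n)))
  -- By computation `⌈ n /2⌉` is ⌊(n+1)/2⌋ and `suc ⌊ n /2⌋` is ⌊(n+2)/2⌋.
  (+-monoʳ-≤ ⌊ n /2⌋ (⌊n/2⌋-mono (n≤1+n (suc n))))

1≤⌊nC2/2⌋ : ∀ k → 1 ≤ ⌊ (3 + k) C 2 /2⌋
1≤⌊nC2/2⌋ k = ⌊n/2⌋-mono {2} (begin
  2                             ≤⟨ m≤m+n 2 k ⟩
  2 + k                         ≡⟨ nC1≡n (2 + k) ⟨
  (2 + k) C 1                   ≤⟨ m≤m+n _ _ ⟩
  (2 + k) C 1 + (2 + k) C 2     ≡⟨ nCk+nC[k+1]≡[n+1]C[k+1] (2 + k) 1 ⟩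
  (3 + k) C 2                   ∎)
  where open ≤-Reasoning

sameCopies⇒≅ : ∀ n → .{{NonZero n}} → n ≢ 2 → {H₁ H₂ : Graph n} →
               SameCopies ⌊ n C 2 /2⌋ H₁ H₂ → H₁ ≅ H₂
sameCopies⇒≅ 1 _ {H₁} {H₂} _ =
  Perm.id , λ { zero zero → trans (adj-irrefl H₁ zero) (sym (adj-irrefl H₂ zero)) }
sameCopies⇒≅ 2 n≢2 _ = contradiction refl n≢2
sameCopies⇒≅ n@(suc (suc (suc k))) _ {H₁} {H₂} same = sameEmbeddings⇒≅ {H₁ = H₁} {H₂}
  (λ A → sameCopies⇒≡embeddings A {H₁ = H₁} {H₂} same) (1≤⌊nC2/2⌋ k)
  (≤-trans (≤-reflexive (length-pairs n)) (n≤⌊n/2⌋+1+⌊n/2⌋ (n C 2)))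

-- Evaluation

labelsAdjacent-label : ∀ (H : Graph n) w {u v} → Var.i w ≡ label u → Var.j w ≡ label v →
                       labelsAdjacent H w ≡ adj H u v
labelsAdjacent-label {n} H (var (suc i) (suc j) _ (s≤s i<j)) {u} {v} refl refl with suc j ≤? n
... | yes j<n = cong₂ (adj H) (Fin.fromℕ<-toℕ u _) (Fin.fromℕ<-toℕ v _)
... | no  j≮n = contradiction (Fin.toℕ<n v) j≮n

module _ {m n} (G : Graph m) (H : Graph n) (r : Increasing 0 m) (π : Permutation′ m) where

  -- The two ways in which the factor of the monomial at `p` can take the value 1 at `H`: exponent
  -- 0, or variable set to 1.
  Present : Pair m → Set
  Present p = a G (π · p) ≡ 0 ⊎ labelsAdjacent H (xᵣ r p) ≡ true

  present? : ∀ p → Dec (Present p)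
  present? p = (a G (π · p) ≟ 0) ⊎-dec (labelsAdjacent H (xᵣ r p) Bool.≟ true)

  present⇒adj : ∀ {k l u v} (k<l : k Fin.< l) → r ‼ k ≡ label u → r ‼ l ≡ label v →
                adj G (π ⟨$⟩ʳ k) (π ⟨$⟩ʳ l) ≡ true → Present (pair k l k<l) → adj H u v ≡ true
  present⇒adj k<l k≡ l≡ kl (inj₁ a≡0) =
    contradiction (trans (sym a≡0) (trans (a-· G π (pair _ _ k<l)) (cong bit kl))) λ ()
  present⇒adj k<l k≡ l≡ kl (inj₂ uv) =
    trans (sym (labelsAdjacent-label H (xᵣ r (pair _ _ k<l)) k≡ l≡)) uv

  present⇒copyIn : All Present (pairs m) → CopyIn G H r π
  present⇒copyIn present u v (copyEdge k l k≡ l≡ kl) with Fin.<-cmp k l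
  ... | tri< k<l _ _  = present⇒adj k<l k≡ l≡ kl (All.lookup present (pair∈pairs _))
  ... | tri≈ _ refl _ = contradiction (trans (sym (adj-irrefl G _)) kl) λ ()
  ... | tri> _ _ l<k  = trans (adj-sym H u v)
    (present⇒adj l<k l≡ k≡ (trans (adj-sym G _ _) kl) (All.lookup present (pair∈pairs _)))

  absent⇒edge : ∀ {p} → ¬ Present p → a G (π · p) ≡ 1 × labelsAdjacent H (xᵣ r p) ≡ false
  absent⇒edge {p} absent with adjₚ G (π · p) | labelsAdjacent H (xᵣ r p)
  ... | false | _     = contradiction (inj₁ refl) absent
  ... | true  | true  = contradiction (inj₂ refl) absent
  ... | true  | false = refl , refl

  absent⇒¬copyIn : Bounded n r → ∀ {p} → ¬ Present p → ¬ CopyIn G H r π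
  absent⇒¬copyIn r≤n {p@(pair k l k<l)} absent copyIn =
    let a≡1 , ¬uv = absent⇒edge absent
        u , u≡ = label-surjective (‼-lower r k) (r≤n k)
        v , v≡ = label-surjective (‼-lower r l) (r≤n l)
        uv = copyIn u v (copyEdge k l (sym u≡) (sym v≡)
               (bit-injective (trans (sym (a-· G π p)) a≡1)))
    in contradiction
         (trans (sym ¬uv) (trans (labelsAdjacent-label H (xᵣ r p) (sym u≡) (sym v≡)) uv))
         λ ()

module _ {c ℓ₁ ℓ₂} (K : HeytingField c ℓ₁ ℓ₂) where

  private
    𝕂 = HeytingCommutativeRing.commutativeRing (HeytingField.heytingCommutativeRing K)
  open CommutativeRing 𝕂
    using (Carrier; _≈_; 0#; 1#; reflexive; +-cong; *-cong; *-congˡ; *-congʳ; zeroˡ; zeroʳ;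
           +-monoid; +-group; semiring)
    renaming (refl to ≈-refl; trans to ≈-trans; sym to ≈-sym; *-identityˡ to *ᴷ-identityˡ)
  open Algebra.Properties.Monoid.Mult +-monoid using (×-homo-+; ×-homo-1) renaming (_×_ to _×ᴷ_)
  open Algebra.Properties.Group +-group using () renaming (∙-cancelˡ to +-cancelˡ)
  open RawSemiringDefinitions (Semiring.rawSemiring semiring) using (_^_)

  -- The hypothesis excludes only that a positive multiple of 1 vanishes; cancelling a 1 on both
  -- sides reduces to that case.
  ×ᴷ-injective : CharacteristicZero K → ∀ k l → k ×ᴷ 1# ≈ l ×ᴷ 1# → k ≡ l
  ×ᴷ-injective char zero    zero    eq = refl
  ×ᴷ-injective char zero    (suc l) eq = contradiction (≈-sym eq) (char l)
  ×ᴷ-injective char (suc k) zero    eq = contradiction eq (char k)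
  ×ᴷ-injective char (suc k) (suc l) eq = cong suc (×ᴷ-injective char k l (+-cancelˡ 1# _ _ eq))

  ∑-cong : ∀ {A : Set} (xs : List A) {f g : A → Carrier} → (∀ x → f x ≈ g x) →
           ∑ K (map f xs) ≈ ∑ K (map g xs)
  ∑-cong []       f≈g = ≈-refl
  ∑-cong (x ∷ xs) f≈g = +-cong (f≈g x) (∑-cong xs f≈g)

  ∑≈sumOver : ∀ {A : Set} (xs : List A) {f : A → Carrier} {w : A → ℕ} →
              (∀ {x} → x ∈ xs → f x ≈ w x ×ᴷ 1#) → ∑ K (map f xs) ≈ sumOver xs w ×ᴷ 1#
  ∑≈sumOver []       f≈w = ≈-refl
  ∑≈sumOver (x ∷ xs) {w = w} f≈w = ≈-trans
    (+-cong (f≈w (here refl)) (∑≈sumOver xs (f≈w ∘ there)))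
    (≈-sym (×-homo-+ 1# (w x) (sumOver xs w)))

  1^≈1 : ∀ e → 1# ^ e ≈ 1#
  1^≈1 zero    = ≈-refl
  1^≈1 (suc e) = ≈-trans (*ᴷ-identityˡ _) (1^≈1 e)

  evalMonomial-one : ∀ {V : Set} (b : V → Carrier) (μ : Monomial V) →
                     All (λ (v , e) → e ≡ 0 ⊎ b v ≡ 1#) μ → evalMonomial K b μ ≈ 1#
  evalMonomial-one b []            []                 = ≈-refl
  evalMonomial-one b ((v , e) ∷ μ) (inj₁ refl ∷ all) =
    ≈-trans (*ᴷ-identityˡ _) (evalMonomial-one b μ all)
  evalMonomial-one b ((v , e) ∷ μ) (inj₂ bv≡1 ∷ all) rewrite bv≡1 =
    ≈-trans (*-cong (1^≈1 e) (evalMonomial-one b μ all)) (*ᴷ-identityˡ _)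

  module _ {m n} (G : Graph m) (H : Graph n) (r : Increasing 0 m) (π : Permutation′ m) where

    -- Boundedness matters: `CopyIn` tests only edges between labels of vertices of `H`, whereas a
    -- variable with an index beyond `n` makes the monomial vanish.
    evalMonomial≈⟦copyIn⟧ : Bounded n r →
      evalMonomial K (b K H) (monomial G r π) ≈ ⟦ copyIn? G H r π ⟧ ×ᴷ 1#
    evalMonomial≈⟦copyIn⟧ r≤n with All.all? (present? G H r π) (pairs m)
    ... | yes present = ≈-trans
      (evalMonomial-one (b K H) _ (All.map⁺ (All.map
        (λ { (inj₁ a≡0) → inj₁ a≡0 ; (inj₂ uv) → inj₂ (cong (if_then 1# else 0#) uv) }) present)))
      (≈-trans (≈-sym (×-homo-1 1#)) (reflexive (cong (_×ᴷ 1#)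
        (sym (⟦⟧-true (copyIn? G H r π) (present⇒copyIn G H r π present))))))
    ... | no ¬present =
      let p , p∈ , absent = find (All.¬All⇒Any¬ (present? G H r π) (pairs m) ¬present)
          a≡1 , ¬uv = absent⇒edge G H r π {p} absent
      in ≈-trans
        (evalMonomial-zero K (b K H) {xᵣ r p} (monomial G r π) (cong (if_then 1# else 0#) ¬uv)
          (subst (λ e → (xᵣ r p , e) ∈ monomial G r π) a≡1
            (∈-map⁺ (λ p → xᵣ r p , a G (π · p)) p∈)))
        (reflexive (cong (_×ᴷ 1#)
          (sym (⟦⟧-false (copyIn? G H r π) (absent⇒¬copyIn G H r π r≤n {p} absent)))))

  -- The finite support chosen for `evalM` is definitionally `indices R`, so both sides run over the
  -- same list and are compared term by term.
  evalM≈copies : ∀ {m n} {G : Graph (2 + m)} (R : Representatives G) G° (H : Graph n) →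
                 evalM K G R G° H ≈ copies R H ×ᴷ 1#
  evalM≈copies {m} {n} {G} R G° H = ∑≈sumOver (indices {n = n} R)
    {w = λ (r , s) → ⟦ copyIn? G H r (Representatives.perm R s) ⟧} λ {(r , s)} i∈ →
    let r∈ , _ = ∈-cartesianProduct⁻ (bounded n 0 _) (allFin (Representatives.size R)) i∈
    in ≈-trans (*ᴷ-identityˡ _)
         (evalMonomial≈⟦copyIn⟧ G H r (Representatives.perm R s) (bounded-sound r r∈))

  module _ {n} (H : Graph n) where

    evalMonomial-setZero-just : ∀ μ {ν} → setZeroMonomial n μ ≡ just ν →
      evalMonomial K (b K H ∘ proj₁) ν ≈ evalMonomial K (b K H) μ
    evalMonomial-setZero-just []                refl = ≈-refl
    evalMonomial-setZero-just ((v , zero) ∷ μ)  eq =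
      ≈-trans (evalMonomial-setZero-just μ eq) (≈-sym (*ᴷ-identityˡ _))
    evalMonomial-setZero-just ((v , suc e) ∷ μ) eq with Var.j v ≤? n
    ... | yes j≤n with setZeroMonomial n μ in eq′ | eq
    ...   | just ν′ | refl = *-congˡ (evalMonomial-setZero-just μ eq′)

    evalMonomial-setZero-nothing : ∀ μ → setZeroMonomial n μ ≡ nothing →
      evalMonomial K (b K H) μ ≈ 0#
    evalMonomial-setZero-nothing ((v , zero) ∷ μ)  eq =
      ≈-trans (*ᴷ-identityˡ _) (evalMonomial-setZero-nothing μ eq)
    evalMonomial-setZero-nothing ((v , suc e) ∷ μ) eq with Var.j v ≤? n
    -- A variable with an index greater than `n` already has the value 0 at `H`, so setting it to 0
    -- beforehand changes nothing.
    ... | no  j≰n rewrite labelsAdjacent-large H v (≰⇒> j≰n) =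
      ≈-trans (*-congʳ (zeroˡ _)) (zeroˡ _)
    ... | yes j≤n with setZeroMonomial n μ in eq′ | eq
    ...   | nothing | _ = ≈-trans (*-congˡ (evalMonomial-setZero-nothing μ eq′)) (zeroʳ _)

    evalTerm-setZero : ∀ q μ →
      evalTerm K (b K H ∘ proj₁) (setZeroTerm K n (q , μ)) ≈ evalTerm K (b K H) (q , μ)
    evalTerm-setZero q μ with setZeroMonomial n μ in eq
    ... | just ν  = *-congˡ (evalMonomial-setZero-just μ eq)
    ... | nothing = ≈-trans (zeroˡ _)
      (≈-sym (≈-trans (*-congˡ (evalMonomial-setZero-nothing μ eq)) (zeroʳ _)))

    -- Both supports are the same list of bounded indices, although one is justified by vanishing
    -- values and the other by vanishing coefficients.
    evalP≈evalM : ∀ {m} (G : Graph m) (R : Representatives G) G° →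
                  evalP K n G R G° H ≈ evalM K G R G° H
    evalP≈evalM {suc zero}    G R G° = ≈-refl
    evalP≈evalM {suc (suc m)} G R G° = ≈-trans
      (reflexive (cong (∑ K) (sym (map-∘ (boundedIndices K G R n)))))
      (∑-cong (boundedIndices K G R n) (λ (r , s) →
        evalTerm-setZero 1# (monomial G r (Representatives.perm R s))))

  ≅⇒evalM≈ : ∀ {H₁ H₂ : Graph n} → H₁ ≅ H₂ → ∀ m (G : Graph m) R G° → m ≤ n →
             evalM K G R G° H₁ ≈ evalM K G R G° H₂
  ≅⇒evalM≈                 iso 1             G R G° _   = ≈-refl
  ≅⇒evalM≈ {H₁ = H₁} {H₂} iso (suc (suc m)) G R G° m≤n = ≈-trans (evalM≈copies R G° H₁)
    (≈-trans (reflexive (cong (_×ᴷ 1#) (copies-≅ R G° m≤n {H₁} {H₂} iso)))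
      (≈-sym (evalM≈copies R G° H₂)))

  evalM≈⇒sameCopies : CharacteristicZero K → ∀ {k} {H₁ H₂ : Graph n} →
    (∀ m (G : Graph m) R (G° : NoIsolatedVertex G) → m ≤ n → edges G ≤ k →
      evalM K G R G° H₁ ≈ evalM K G R G° H₂) →
    SameCopies k H₁ H₂
  evalM≈⇒sameCopies char {H₁ = H₁} {H₂} eval≈ G G° m≤n G≤k = ×ᴷ-injective char _ _
    (≈-trans (≈-sym (evalM≈copies (representatives G) G° H₁))
      (≈-trans (eval≈ _ G (representatives G) G° m≤n G≤k) (evalM≈copies (representatives G) G° H₂)))

theorem4p5 : ∀ {c ℓ₁ ℓ₂} (K : HeytingField c ℓ₁ ℓ₂) → CharacteristicZero K →
    let open HeytingField K using (_≈_) in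
    ∀ n .{{_ : NonZero n}} → n ≢ 2 → (H₁ H₂ : Graph n) →
    (H₁ ≅ H₂ ⇔
    (∀ m (G : Graph m) (R : Representatives G) (G° : NoIsolatedVertex G) →
    m ≤ n → edges G ≤ ⌊ n C 2 /2⌋ →
    evalP K n G R G° H₁ ≈ evalP K n G R G° H₂))
    ×
    (H₁ ≅ H₂ ⇔
    (∀ m (G : Graph m) (R : Representatives G) (G° : NoIsolatedVertex G) →
    m ≤ n → edges G ≤ ⌊ n C 2 /2⌋ →
    evalM K G R G° H₁ ≈ evalM K G R G° H₂))
theorem4p5 K char n n≢2 H₁ H₂ =
  mk⇔ (λ iso m G R G° m≤n _ → ≈-trans (evalP≈evalM K H₁ G R G°)
         (≈-trans (≅⇒evalM≈ K iso m G R G° m≤n) (≈-sym (evalP≈evalM K H₂ G R G°))))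
      (λ evalP≈ → iso-if λ m G R G° m≤n G≤ → ≈-trans (≈-sym (evalP≈evalM K H₁ G R G°))
         (≈-trans (evalP≈ m G R G° m≤n G≤) (evalP≈evalM K H₂ G R G°))) ,
  mk⇔ (λ iso m G R G° m≤n _ → ≅⇒evalM≈ K iso m G R G° m≤n)
      iso-if
  where
  open HeytingField K using (_≈_) renaming (sym to ≈-sym; trans to ≈-trans)

  iso-if : (∀ m (G : Graph m) R (G° : NoIsolatedVertex G) → m ≤ n → edges G ≤ ⌊ n C 2 /2⌋ →
             evalM K G R G° H₁ ≈ evalM K G R G° H₂) → H₁ ≅ H₂
  iso-if evalM≈ = sameCopies⇒≅ n n≢2 (evalM≈⇒sameCopies K char {H₁ = H₁} {H₂} evalM≈)
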